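{- Let $n$ be a positive integer with $n\equiv 11$ or $15 \pmod{20}$ and $n\neq 15$. Then there exists a configuration $(1,5)$ $GDD\left(n,2,6;2n,n-1\right)$.
   Context: A $GDD(n,2,6;\lambda_1,\lambda_2)$ is a finite collection (repetitions allowed) of $6$-element subsets, called blocks, of a $2n$-element set $X$ partitioned into two groups of size $n$, such that every point lies in the same number $r$ of blocks, any two distinct points of the same group lie together in exactly $\lambda_1$ blocks, and any two points from different groups lie together in exactly $\lambda_2$ blocks. It has configuration $(1,5)$ if every block has exactly $1$ point in one of the two groups and $5$ points in the other (which group contains the single point may depend on the block). -}

module Defs where

open import Data.Nat using (ℕ; _*_)
open import Data.Fin using (Fin; zero; suc; _≟_)
open import Data.Fin.Subset using (Subset; _∩_; ∣_∣)
open import Data.Fin.Subset.Properties using (_∈?_)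
open import Data.List using (List; length; filter)
open import Data.List.Relation.Unary.All using (All)
open import Data.Product using (_×_)
open import Data.Sum using (_⊎_)
open import Data.Vec using (tabulate)
open import Relation.Binary.PropositionalEquality using (_≡_; _≢_)
open import Relation.Nullary.Decidable using (does; _×-dec_)

fibre : ∀ {v m} → (Fin v → Fin m) → Fin m → Subset v
fibre f g = tabulate (λ x → does (f x ≟ g))

-- Blocks form a list because repeated blocks count with multiplicity.
replication : ∀ {v} → List (Subset v) → Fin v → ℕ
replication Bs x = length (filter (λ B → x ∈? B) Bs)

concurrence : ∀ {v} → List (Subset v) → Fin v → Fin v → ℕ
concurrence Bs x y = length (filter (λ B → (x ∈? B) ×-dec (y ∈? B)) Bs)

-- GDD(n, m, k; λ₁, λ₂): m groups of size n, blocks of size k.  The partition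
-- into groups is given by the map sending a point to its group, so
-- disjointness and covering hold automatically.
record GDD (n m k λ₁ λ₂ : ℕ) : Set where
  field
    groupOf : Fin (m * n) → Fin m
    blocks  : List (Subset (m * n))
    r       : ℕ

  group : Fin m → Subset (m * n)
  group = fibre groupOf

  field
    group-size     : ∀ g → ∣ group g ∣ ≡ n
    block-size     : All (λ B → ∣ B ∣ ≡ k) blocks
    regular        : ∀ x → replication blocks x ≡ r
    same-group     : ∀ x y → x ≢ y → groupOf x ≡ groupOf y →
                     concurrence blocks x y ≡ λ₁
    distinct-group : ∀ x y → groupOf x ≢ groupOf y →
                     concurrence blocks x y ≡ λ₂

-- The group playing the role of s may vary from block to block.
HasConfiguration : ∀ {n k λ₁ λ₂} → ℕ → ℕ → GDD n 2 k λ₁ λ₂ → Set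
HasConfiguration s t D = All Splits blocks
  where
  open GDD D
  Splits : Subset _ → Set
  Splits B =
    (∣ B ∩ group zero ∣ ≡ s × ∣ B ∩ group (suc zero) ∣ ≡ t) ⊎
    (∣ B ∩ group zero ∣ ≡ t × ∣ B ∩ group (suc zero) ∣ ≡ s)

{-# OPTIONS --safe #-}

-- Give every five-point block on one group a colour, a point of the other group.
-- If the coloured blocks on n points cover each pair 2n times, and the blocks of
-- each colour cover each point (n - 1)/2 times, then joining blocks to their
-- colours, once in each direction, yields the design.
--
-- Write n = u + w s with s odd and (u , w) = (0 , 5) or (1 , 10).  Points (and
-- colours) are u fixed points and w copies of ℤ/s, and base blocks, developed by
-- translation, consist of points a x + b y in prescribed copies, a, b ∈ {0, ±1}.
-- Coefficients that differ, differ by ±1 or ±2, a unit of ℤ/s whatever the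
-- factorisation of s, so two such points realise all differences equally often as
-- x or y varies; differences inside a copy come from pairs ±x and ±y.  Hence the
-- number of blocks through two points is a polynomial in s that depends only on
-- their copies and on whether their residues agree, and for fixed (u , w) it
-- remains to verify finitely many identities between coefficients.

module Submission where

open import Algebra.Bundles using (AbelianGroup)
open import Algebra.Consequences.Propositional using (comm∧idˡ⇒id; comm∧invˡ⇒inv)
import Algebra.Properties.AbelianGroup as AbelianGroupProperties
open import Algebra.Structures using (IsAbelianGroup)
open import Data.Bool using (Bool; true; false; if_then_else_; _∧_)
open import Data.Fin using (Fin; zero; suc; toℕ; _≟_; _≤_; _≤?_; opposite; combine; remQuot; join; splitAt; _↑ˡ_; _↑ʳ_)
open import Data.Fin.Properties
  using ( all?; ≤-total; suc-injective; toℕ-injective; toℕ-fromℕ<; toℕ<n; toℕ-↑ˡ; toℕ-↑ʳ; opposite-prop; opposite-involutive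
        ; combine-injective; remQuot-combine; combine-remQuot; splitAt-join; join-splitAt)
open import Data.Fin.Subset using (Subset; _∩_; ∣_∣)
open import Data.Fin.Subset.Properties using () renaming (_∈?_ to _∈ˢ?_)
open import Data.List
  using (List; []; _∷_; _++_; map; concatMap; filter; length; allFin; tabulate; upTo; zipWith)
import Data.List.Membership.DecPropositional as DecMembership
open import Data.List.Properties using (map-tabulate; map-cong; map-∘; length-map; length-tabulate)
open import Data.List.Relation.Unary.All as All using (All; []; _∷_)
import Data.List.Relation.Unary.All.Properties as All
open import Data.List.Relation.Unary.AllPairs using ([]; _∷_)
import Data.List.Relation.Unary.Unique.DecPropositional as DecUnique
open import Data.List.Relation.Unary.Unique.Propositional using (Unique)
import Data.List.Relation.Unary.Unique.Propositional.Properties as Unique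
open import Data.Nat as ℕ using (ℕ; zero; suc; _+_; _*_; _∸_; _<_; _%_; _/_; _<ᵇ_)
open import Data.Nat.DivMod
  using ( _mod_; m%n<n; m*n/n≡m; m<n⇒m%n≡m; m%n%n≡m%n; n%n≡0; %-congˡ; %-distribˡ-+; %-distribˡ-*
        ; [m+kn]%n≡m%n; m≡m%n+[m/n]*n)
open import Data.Nat.Properties
  using ( +-assoc; +-comm; +-identityʳ; +-cancelʳ-≡; *-assoc; *-comm; *-identityˡ; *-identityʳ; *-zeroʳ
        ; *-distribˡ-+; *-distribʳ-+; *-cancelˡ-≡; <⇒≤; m∸n+n≡m; m+n∸n≡m)
open import Data.Nat.Solver using (module +-*-Solver)
open import Data.Product using (∃; _×_; _,_; proj₁; proj₂; uncurry)
import Data.Product.Properties as Product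
open import Data.Sum as Sum using (_⊎_; inj₁; inj₂)
import Data.Sum.Properties as Sum
open import Data.Vec as Vec using (Vec; []; _∷_; replicate; lookup)
import Data.Vec.Properties as Vec
open import Function using (_∘_; id; mk⇔)
open import Relation.Binary using (DecidableEquality)
open import Relation.Binary.PropositionalEquality
  using (_≡_; _≢_; refl; sym; trans; cong; cong₂; subst; isEquivalence; module ≡-Reasoning)
open import Relation.Nullary using (Dec; yes; no; does; contradiction; ¬_)
open import Relation.Nullary.Decidable
  using (_×-dec_; _⊎-dec_; _→-dec_; ¬?; map′; does-⇔; dec-true; dec-false; toWitness)
open import Relation.Unary using (Decidable)
open import Defs

open ≡-Reasoning

-- Planes and lines meet each copy at most once, so pairs of points inside one copy need blocks
-- containing x, -x or y, -y. Such a block is unchanged when y becomes -y, so it is developed over a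
-- half system only; this also supplies the odd multiplicity that the degree (n - 1)/2 requires when
-- w is odd.
--
-- A half system is awkward for counting: a linear equation has one solution in all of ℤ/s, but
-- possibly none in a half system. What rescues the count is the evenness itself: the full sum of an
-- even function is its value at 0 plus twice its half sum. Hence everything is counted twice over,
-- and terms with x = 0 or y = 0 appear as corrections, moved to the other side of each identity to
-- stay within the natural numbers.
--
-- The value x = 0 needs separate treatment because x and -x collide there; the doubled shapes
-- replace the crossed ones. The corrections depend on whether the residues agree, and the lines,
-- which have the same order in s, are chosen to cancel this dependence.

private
  variable
    A B P Q : Set
    n : ℕ

-- Finite sums and indicators

∑ : List A → (A → ℕ) → ℕ
∑ []       f = 0
∑ (x ∷ xs) f = f x + ∑ xs f

∑-cong : ∀ (xs : List A) {f g} → (∀ x → f x ≡ g x) → ∑ xs f ≡ ∑ xs g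
∑-cong []       eq = refl
∑-cong (x ∷ xs) eq = cong₂ _+_ (eq x) (∑-cong xs eq)

∑-cong-All : ∀ {xs : List A} {R : A → Set} {f g} →
             All R xs → (∀ x → R x → f x ≡ g x) → ∑ xs f ≡ ∑ xs g
∑-cong-All []       eq = refl
∑-cong-All (r ∷ rs) eq = cong₂ _+_ (eq _ r) (∑-cong-All rs eq)

∑-zero : ∀ (xs : List A) → ∑ xs (λ _ → 0) ≡ 0
∑-zero []       = refl
∑-zero (x ∷ xs) = ∑-zero xs

∑-const : ∀ (xs : List A) c → ∑ xs (λ _ → c) ≡ length xs * c
∑-const []       c = refl
∑-const (x ∷ xs) c = cong (c +_) (∑-const xs c)

+-interchange : ∀ a b c d → (a + b) + (c + d) ≡ (a + c) + (b + d)
+-interchange = solve 4 (λ a b c d → (a :+ b) :+ (c :+ d) := (a :+ c) :+ (b :+ d)) refl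
  where open +-*-Solver

∑-+ : ∀ (xs : List A) f g → ∑ xs (λ x → f x + g x) ≡ ∑ xs f + ∑ xs g
∑-+ []       f g = refl
∑-+ (x ∷ xs) f g =
  trans (cong (f x + g x +_) (∑-+ xs f g)) (+-interchange (f x) (g x) _ _)

∑-*ˡ : ∀ (xs : List A) c f → ∑ xs (λ x → c * f x) ≡ c * ∑ xs f
∑-*ˡ []       c f = sym (*-zeroʳ c)
∑-*ˡ (x ∷ xs) c f =
  trans (cong (c * f x +_) (∑-*ˡ xs c f)) (sym (*-distribˡ-+ c (f x) _))

∑-*ʳ : ∀ (xs : List A) c f → ∑ xs (λ x → f x * c) ≡ ∑ xs f * c
∑-*ʳ xs c f = trans (∑-cong xs (λ x → *-comm (f x) c))
                    (trans (∑-*ˡ xs c f) (*-comm c _))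

∑-++ : ∀ (xs ys : List A) f → ∑ (xs ++ ys) f ≡ ∑ xs f + ∑ ys f
∑-++ []       ys f = refl
∑-++ (x ∷ xs) ys f = trans (cong (f x +_) (∑-++ xs ys f)) (sym (+-assoc (f x) _ _))

∑-map : ∀ (g : A → B) xs f → ∑ (map g xs) f ≡ ∑ xs (f ∘ g)
∑-map g []       f = refl
∑-map g (x ∷ xs) f = cong (f (g x) +_) (∑-map g xs f)

∑-concatMap : ∀ (g : A → List B) xs f → ∑ (concatMap g xs) f ≡ ∑ xs (λ x → ∑ (g x) f)
∑-concatMap g []       f = refl
∑-concatMap g (x ∷ xs) f =
  trans (∑-++ (g x) (concatMap g xs) f) (cong (∑ (g x) f +_) (∑-concatMap g xs f))

∑-swap : ∀ (xs : List A) (ys : List B) (f : A → B → ℕ) →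
         ∑ xs (λ x → ∑ ys (f x)) ≡ ∑ ys (λ y → ∑ xs (λ x → f x y))
∑-swap []       ys f = sym (∑-zero ys)
∑-swap (x ∷ xs) ys f =
  trans (cong (∑ ys (f x) +_) (∑-swap xs ys f)) (sym (∑-+ ys (f x) _))

∑-product : ∀ (xs : List A) (ys : List B) f g →
            ∑ xs f * ∑ ys g ≡ ∑ xs (λ x → ∑ ys (λ y → f x * g y))
∑-product xs ys f g = trans (sym (∑-*ʳ xs (∑ ys g) f))
                            (∑-cong xs (λ x → sym (∑-*ˡ ys (f x) g)))

∑-tabulate : ∀ (g : Fin n → A) f → ∑ (tabulate g) f ≡ ∑ (allFin n) (f ∘ g)
∑-tabulate g f = trans (cong (λ xs → ∑ xs f) (sym (map-tabulate id g))) (∑-map g (allFin _) f)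

∑-allFin-suc : ∀ (f : Fin (suc n) → ℕ) →
               ∑ (allFin (suc n)) f ≡ f zero + ∑ (allFin n) (f ∘ suc)
∑-allFin-suc f = cong (f zero +_) (∑-tabulate suc f)

⟦_⟧ : Dec P → ℕ
⟦ p ⟧ = if does p then 1 else 0

⟦⟧-cong : (P → Q) → (Q → P) → (p : Dec P) (q : Dec Q) → ⟦ p ⟧ ≡ ⟦ q ⟧
⟦⟧-cong f g p q = cong (if_then 1 else 0) (does-⇔ (mk⇔ f g) p q)

⟦⟧-false : (p : Dec P) → ¬ P → ⟦ p ⟧ ≡ 0
⟦⟧-false p ¬x = cong (if_then 1 else 0) (dec-false p ¬x)

⟦⟧-× : (p : Dec P) (q : Dec Q) → ⟦ p ×-dec q ⟧ ≡ ⟦ p ⟧ * ⟦ q ⟧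
⟦⟧-× (yes _) (yes _) = refl
⟦⟧-× (yes _) (no _)  = refl
⟦⟧-× (no _)  _       = refl

length-filter : ∀ {R : A → Set} (R? : Decidable R) xs →
                length (filter R? xs) ≡ ∑ xs (λ x → ⟦ R? x ⟧)
length-filter R? []       = refl
length-filter R? (x ∷ xs) with does (R? x)
... | true  = cong suc (length-filter R? xs)
... | false = length-filter R? xs

∑-filter : ∀ {R : A → Set} (R? : Decidable R) xs (f : A → ℕ) →
           ∑ (filter R? xs) f ≡ ∑ xs (λ x → ⟦ R? x ⟧ * f x)
∑-filter R? []       f = refl
∑-filter R? (x ∷ xs) f with does (R? x)
... | true  = cong₂ _+_ (sym (*-identityˡ (f x))) (∑-filter R? xs f)
... | false = ∑-filter R? xs f

∑-sift : ∀ (j : Fin n) (f : Fin n → ℕ) → ∑ (allFin n) (λ i → ⟦ j ≟ i ⟧ * f i) ≡ f j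
∑-sift {suc n} zero    f =
  trans (∑-allFin-suc (λ i → ⟦ zero ≟ i ⟧ * f i))
        (trans (cong₂ _+_ (*-identityˡ (f zero)) (∑-zero (allFin n))) (+-identityʳ (f zero)))
∑-sift {suc n} (suc j) f =
  trans (∑-allFin-suc (λ i → ⟦ suc j ≟ i ⟧ * f i))
        (trans (∑-cong (allFin n) (λ i → cong (_* f (suc i)) (⟦⟧-cong suc-injective (cong suc) (suc j ≟ suc i) (j ≟ i))))
               (∑-sift j (f ∘ suc)))

∑-sift′ : ∀ {R : Fin n → Set} (R? : Decidable R) j → (∀ i → R i → j ≡ i) → R j →
          ∀ (f : Fin n → ℕ) → ∑ (allFin n) (λ i → ⟦ R? i ⟧ * f i) ≡ f j
∑-sift′ {n} {R} R? j uniq rj f = trans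
  (∑-cong (allFin n) (λ i → cong (_* f i)
    (⟦⟧-cong (uniq i) (λ eq → subst R eq rj) (R? i) (j ≟ i))))
  (∑-sift j f)

∑-unique : ∀ {R : Fin n → Set} (R? : Decidable R) j → (∀ i → R i → j ≡ i) → R j →
           ∑ (allFin n) (λ i → ⟦ R? i ⟧) ≡ 1
∑-unique {n} R? j uniq rj = trans (∑-cong (allFin n) (λ i → sym (*-identityʳ ⟦ R? i ⟧)))
                            (∑-sift′ R? j uniq rj (λ _ → 1))

-- Blocks as duplicate-free lists

module Multiplicity (_≟ᴬ_ : DecidableEquality A) where

  open DecMembership _≟ᴬ_ public using (_∈?_)

  mult : List A → A → ℕ
  mult xs a = ∑ xs (λ x → ⟦ a ≟ᴬ x ⟧)

  mult-absent : ∀ {xs a} → All (a ≢_) xs → mult xs a ≡ 0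
  mult-absent []         = refl
  mult-absent {x ∷ xs} {a} (a≢x ∷ a≢) =
    cong₂ _+_ (⟦⟧-false (a ≟ᴬ x) a≢x) (mult-absent a≢)

  -- Without repetitions membership becomes a sum over the entries, so incidence counts reduce to
  -- exchanging finite sums.
  mult-unique : ∀ {xs} → Unique xs → ∀ a → ⟦ a ∈? xs ⟧ ≡ mult xs a
  mult-unique []                   a = refl
  mult-unique {x ∷ xs} (x≢ ∷ uniq) a with a ≟ᴬ x
  ... | yes refl = cong suc (sym (mult-absent x≢))
  ... | no _     = mult-unique uniq a

⟦∈ˢ⟧ : ∀ {m} (v : Fin m) (p : Subset m) → ⟦ v ∈ˢ? p ⟧ ≡ (if Vec.lookup p v then 1 else 0)
⟦∈ˢ⟧ zero    (true  Vec.∷ p) = refl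
⟦∈ˢ⟧ zero    (false Vec.∷ p) = refl
⟦∈ˢ⟧ (suc v) (_     Vec.∷ p) = ⟦∈ˢ⟧ v p

∣∣-∑ : ∀ {m} (p : Subset m) → ∣ p ∣ ≡ ∑ (allFin m) (λ v → if Vec.lookup p v then 1 else 0)
∣∣-∑ Vec.[]            = refl
∣∣-∑ p@(true Vec.∷ q)  = trans (cong suc (∣∣-∑ q)) (sym (∑-allFin-suc (λ v → if Vec.lookup p v then 1 else 0)))
∣∣-∑ p@(false Vec.∷ q) = trans (∣∣-∑ q) (sym (∑-allFin-suc (λ v → if Vec.lookup p v then 1 else 0)))

module _ {N : ℕ} where

  open Multiplicity (_≟_ {n = N})

  toSubset : List (Fin N) → Subset N
  toSubset xs = Vec.tabulate (λ v → does (v ∈? xs))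

  ∈-toSubset : ∀ {xs} → Unique xs → ∀ v → ⟦ v ∈ˢ? toSubset xs ⟧ ≡ mult xs v
  ∈-toSubset {xs} uniq v = begin
    ⟦ v ∈ˢ? toSubset xs ⟧                             ≡⟨ ⟦∈ˢ⟧ v (toSubset xs) ⟩
    (if Vec.lookup (toSubset xs) v then 1 else 0)     ≡⟨ cong (if_then 1 else 0) (Vec.lookup∘tabulate _ v) ⟩
    ⟦ v ∈? xs ⟧                                       ≡⟨ mult-unique uniq v ⟩
    mult xs v                                         ∎

  ∣toSubset∩tabulate∣ : ∀ {xs} → Unique xs → (f : Fin N → Bool) →
    ∣ toSubset xs ∩ Vec.tabulate f ∣ ≡ ∑ xs (λ x → if f x then 1 else 0)
  ∣toSubset∩tabulate∣ {xs} uniq f = begin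
    ∣ toSubset xs ∩ Vec.tabulate f ∣
      ≡⟨ ∣∣-∑ (toSubset xs ∩ Vec.tabulate f) ⟩
    ∑ (allFin N) (λ v → if Vec.lookup (toSubset xs ∩ Vec.tabulate f) v then 1 else 0)
      ≡⟨ ∑-cong (allFin N) pointwise ⟩
    ∑ (allFin N) (λ v → ∑ xs (λ x → ⟦ v ≟ x ⟧ * (if f v then 1 else 0)))
      ≡⟨ ∑-swap (allFin N) xs _ ⟩
    ∑ xs (λ x → ∑ (allFin N) (λ v → ⟦ v ≟ x ⟧ * (if f v then 1 else 0)))
      ≡⟨ ∑-cong xs (λ x → ∑-sift′ (_≟ x) x (λ _ → sym) refl (λ v → if f v then 1 else 0)) ⟩
    ∑ xs (λ x → if f x then 1 else 0) ∎
    where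
    if-∧ : ∀ b c → (if b ∧ c then 1 else 0) ≡ (if b then 1 else 0) * (if c then 1 else 0)
    if-∧ true  true  = refl
    if-∧ true  false = refl
    if-∧ false _     = refl

    pointwise : ∀ v → (if Vec.lookup (toSubset xs ∩ Vec.tabulate f) v then 1 else 0) ≡
                      ∑ xs (λ x → ⟦ v ≟ x ⟧ * (if f v then 1 else 0))
    pointwise v = begin
      (if Vec.lookup (toSubset xs ∩ Vec.tabulate f) v then 1 else 0)
        ≡⟨ cong (if_then 1 else 0) (Vec.lookup-zipWith _∧_ v (toSubset xs) (Vec.tabulate f)) ⟩
      (if Vec.lookup (toSubset xs) v ∧ Vec.lookup (Vec.tabulate f) v then 1 else 0)
        ≡⟨ cong₂ (λ b c → if b ∧ c then 1 else 0) (Vec.lookup∘tabulate _ v) (Vec.lookup∘tabulate f v) ⟩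
      (if does (v ∈? xs) ∧ f v then 1 else 0)
        ≡⟨ if-∧ (does (v ∈? xs)) (f v) ⟩
      ⟦ v ∈? xs ⟧ * (if f v then 1 else 0)
        ≡⟨ cong (_* (if f v then 1 else 0)) (mult-unique uniq v) ⟩
      mult xs v * (if f v then 1 else 0)
        ≡⟨ sym (∑-*ʳ xs (if f v then 1 else 0) (λ x → ⟦ v ≟ x ⟧)) ⟩
      ∑ xs (λ x → ⟦ v ≟ x ⟧ * (if f v then 1 else 0)) ∎

  ∣toSubset∣ : ∀ {xs} → Unique xs → ∣ toSubset xs ∣ ≡ length xs
  ∣toSubset∣ {xs} uniq = begin
    ∣ toSubset xs ∣                                     ≡⟨ ∣∣-∑ (toSubset xs) ⟩
    ∑ (allFin N) (λ v → if Vec.lookup (toSubset xs) v then 1 else 0)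
      ≡⟨ ∑-cong (allFin N) (λ v → trans (cong (if_then 1 else 0) (Vec.lookup∘tabulate _ v)) (mult-unique uniq v)) ⟩
    ∑ (allFin N) (mult xs)                              ≡⟨ ∑-swap (allFin N) xs _ ⟩
    ∑ xs (λ x → ∑ (allFin N) (λ v → ⟦ v ≟ x ⟧))         ≡⟨ ∑-cong xs (λ x → ∑-unique (_≟ x) x (λ _ → sym) refl) ⟩
    ∑ xs (λ _ → 1)                                      ≡⟨ ∑-const xs 1 ⟩
    length xs * 1                                       ≡⟨ *-identityʳ _ ⟩
    length xs                                           ∎

-- From coloured five-point blocks to the design

module FromColouring
  {A : Set} (_≟ᴬ_ : DecidableEquality A)
  (enc : A → Fin n) (dec : Fin n → A)
  (dec-enc : ∀ a → dec (enc a) ≡ a) (enc-dec : ∀ i → enc (dec i) ≡ i)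
  where

  open Multiplicity _≟ᴬ_

  points : List A
  points = map dec (allFin n)

  length-points : length points ≡ n
  length-points = begin
    length points              ≡⟨ sym (*-identityʳ _) ⟩
    length points * 1          ≡⟨ sym (∑-const points 1) ⟩
    ∑ points (λ _ → 1)         ≡⟨ ∑-map dec (allFin n) (λ _ → 1) ⟩
    ∑ (allFin n) (λ _ → 1)     ≡⟨ ∑-const (allFin n) 1 ⟩
    length (allFin n) * 1      ≡⟨ *-identityʳ _ ⟩
    length (allFin n)          ≡⟨ length-tabulate id ⟩
    n                          ∎

  ∑-points : ∀ a → ∑ points (λ b → ⟦ b ≟ᴬ a ⟧) ≡ 1
  ∑-points a = trans (∑-map dec (allFin n) (λ b → ⟦ b ≟ᴬ a ⟧))
    (∑-unique (λ i → dec i ≟ᴬ a) (enc a)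
      (λ i eq → trans (cong enc (sym eq)) (enc-dec i)) (dec-enc a))

  ∑-points-mult : ∀ B → ∑ points (mult B) ≡ length B
  ∑-points-mult B = begin
    ∑ points (mult B)                            ≡⟨ ∑-swap points B (λ a b → ⟦ a ≟ᴬ b ⟧) ⟩
    ∑ B (λ b → ∑ points (λ a → ⟦ a ≟ᴬ b ⟧))      ≡⟨ ∑-cong B ∑-points ⟩
    ∑ B (λ _ → 1)                                ≡⟨ ∑-const B 1 ⟩
    length B * 1                                 ≡⟨ *-identityʳ _ ⟩
    length B                                     ∎

  groupOf : Fin (2 * n) → Fin 2
  groupOf v = proj₁ (remQuot {2} n v)

  pt : Fin 2 → A → Fin (2 * n)
  pt g a = combine g (enc a)

  groupOf-pt : ∀ g a → groupOf (pt g a) ≡ g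
  groupOf-pt g a = cong proj₁ (remQuot-combine g (enc a))

  pt-injective : ∀ {g k a b} → pt g a ≡ pt k b → g ≡ k × a ≡ b
  pt-injective {g} {k} {a} {b} eq with combine-injective g (enc a) k (enc b) eq
  ... | g≡k , ea≡eb = g≡k , trans (sym (dec-enc a)) (trans (cong dec ea≡eb) (dec-enc b))

  data Point : Fin (2 * n) → Set where
    point : ∀ g a → Point (pt g a)

  point? : ∀ v → Point v
  point? v = subst Point pt≡v (point g (dec i))
    where
    g = groupOf v
    i = proj₂ (remQuot {2} n v)
    pt≡v : pt g (dec i) ≡ v
    pt≡v = trans (cong (combine g) (enc-dec i)) (combine-remQuot {2} n v)

  ⟦pt≟pt⟧ : ∀ g a k b → ⟦ pt g a ≟ pt k b ⟧ ≡ ⟦ g ≟ k ⟧ * ⟦ a ≟ᴬ b ⟧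
  ⟦pt≟pt⟧ g a k b = trans
    (⟦⟧-cong pt-injective (λ { (refl , refl) → refl }) (pt g a ≟ pt k b) ((g ≟ k) ×-dec (a ≟ᴬ b)))
    (⟦⟧-× (g ≟ k) (a ≟ᴬ b))

  open Multiplicity (_≟_ {n = 2 * n}) using () renaming (mult to multˢ)

  multˢ-map-pt : ∀ g a k xs → multˢ (map (pt k) xs) (pt g a) ≡ ⟦ g ≟ k ⟧ * mult xs a
  multˢ-map-pt g a k xs = begin
    multˢ (map (pt k) xs) (pt g a)                  ≡⟨ ∑-map (pt k) xs (λ x → ⟦ pt g a ≟ x ⟧) ⟩
    ∑ xs (λ x → ⟦ pt g a ≟ pt k x ⟧)                ≡⟨ ∑-cong xs (⟦pt≟pt⟧ g a k) ⟩
    ∑ xs (λ x → ⟦ g ≟ k ⟧ * ⟦ a ≟ᴬ x ⟧)             ≡⟨ ∑-*ˡ xs ⟦ g ≟ k ⟧ _ ⟩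
    ⟦ g ≟ k ⟧ * mult xs a                           ∎

  size-fibre : ∀ g → ∣ fibre groupOf g ∣ ≡ n
  size-fibre g = begin
    ∣ fibre groupOf g ∣
      ≡⟨ ∣∣-∑ (fibre groupOf g) ⟩
    ∑ (allFin (2 * n)) (λ v → if Vec.lookup (fibre groupOf g) v then 1 else 0)
      ≡⟨ ∑-cong (allFin (2 * n)) (λ v → trans (cong (if_then 1 else 0) (Vec.lookup∘tabulate _ v)) (pointwise (point? v))) ⟩
    ∑ (allFin (2 * n)) (multˢ (map (pt g) points))
      ≡⟨ ∑-swap (allFin (2 * n)) (map (pt g) points) (λ v x → ⟦ v ≟ x ⟧) ⟩
    ∑ (map (pt g) points) (λ x → ∑ (allFin (2 * n)) (λ v → ⟦ v ≟ x ⟧))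
      ≡⟨ ∑-cong (map (pt g) points) (λ x → ∑-unique (λ v → v ≟ x) x (λ _ → sym) refl) ⟩
    ∑ (map (pt g) points) (λ _ → 1)
      ≡⟨ ∑-map (pt g) points (λ _ → 1) ⟩
    ∑ points (λ _ → 1)
      ≡⟨ ∑-const points 1 ⟩
    length points * 1
      ≡⟨ *-identityʳ _ ⟩
    length points
      ≡⟨ length-points ⟩
    n ∎
    where
    pointwise : ∀ {v} → Point v → ⟦ groupOf v ≟ g ⟧ ≡ multˢ (map (pt g) points) v
    pointwise (point k a) = begin
      ⟦ groupOf (pt k a) ≟ g ⟧               ≡⟨ cong (λ l → ⟦ l ≟ g ⟧) (groupOf-pt k a) ⟩
      ⟦ k ≟ g ⟧                              ≡⟨ sym (*-identityʳ _) ⟩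
      ⟦ k ≟ g ⟧ * 1                          ≡⟨ cong (⟦ k ≟ g ⟧ *_) (sym (trans (∑-cong points (λ b → ⟦⟧-cong sym sym (a ≟ᴬ b) (b ≟ᴬ a))) (∑-points a))) ⟩
      ⟦ k ≟ g ⟧ * mult points a              ≡⟨ sym (multˢ-map-pt k a g points) ⟩
      multˢ (map (pt g) points) (pt k a)     ∎

  module Construction
    (h : ℕ) (odd : h + h + 1 ≡ n)
    (D : List (A × List A))
    (proper : All (λ (c , B) → Unique B × length B ≡ 5) D)
    (pairs : ∀ a b → a ≢ b → ∑ D (λ (c , B) → mult B a * mult B b) ≡ 2 * n)
    (colours : ∀ c a → ∑ D (λ (c′ , B) → ⟦ c ≟ᴬ c′ ⟧ * mult B a) ≡ h)
    where

    line : Fin 2 → A × List A → List (Fin (2 * n))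
    line g (c , B) = pt (opposite g) c ∷ map (pt g) B

    blocks : List (Subset (2 * n))
    blocks = concatMap (λ d → toSubset (line zero d) ∷ toSubset (line (suc zero) d) ∷ []) D

    opposite-≢ : ∀ (g : Fin 2) → opposite g ≢ g
    opposite-≢ zero       ()
    opposite-≢ (suc zero) ()

    line-unique : ∀ g d → Unique (proj₂ d) → Unique (line g d)
    line-unique g (c , B) uniq =
      All.map⁺ (All.universal (λ b eq → opposite-≢ g (proj₁ (pt-injective eq))) B) ∷
      Unique.map⁺ (λ eq → proj₂ (pt-injective {g} {g} eq)) uniq

    mult-line : ∀ g k a c B →
      multˢ (line k (c , B)) (pt g a) ≡ ⟦ g ≟ opposite k ⟧ * ⟦ a ≟ᴬ c ⟧ + ⟦ g ≟ k ⟧ * mult B a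
    mult-line g k a c B = cong₂ _+_ (⟦pt≟pt⟧ g a (opposite k) c) (multˢ-map-pt g a k B)

    mult-line-own : ∀ g a c B → multˢ (line g (c , B)) (pt g a) ≡ mult B a
    mult-line-own zero       a c B = trans (mult-line zero zero a c B) (+-identityʳ _)
    mult-line-own (suc zero) a c B = trans (mult-line (suc zero) (suc zero) a c B) (+-identityʳ _)

    mult-line-other : ∀ g a c B → multˢ (line (opposite g) (c , B)) (pt g a) ≡ ⟦ a ≟ᴬ c ⟧
    mult-line-other zero       a c B = trans (mult-line zero (suc zero) a c B) (trans (+-identityʳ _) (+-identityʳ _))
    mult-line-other (suc zero) a c B = trans (mult-line (suc zero) zero a c B) (trans (+-identityʳ _) (+-identityʳ _))

    -- The group `g` is arbitrary, so that the block lying mainly in the group of a given point can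
    -- always be put first and the counts below treat both groups at once.
    ∑-blocks : ∀ g (f : Subset (2 * n) → ℕ) (f′ : List (Fin (2 * n)) → ℕ) →
      (∀ {L} → Unique L → f (toSubset L) ≡ f′ L) →
      ∑ blocks f ≡ ∑ D (λ d → f′ (line g d) + f′ (line (opposite g) d))
    ∑-blocks g f f′ f≡f′ = trans
      (∑-concatMap _ D f)
      (∑-cong-All proper (λ d (uniq , _) → trans
        (cong₂ _+_ (f≡f′ (line-unique zero d uniq))
                   (trans (+-identityʳ _) (f≡f′ (line-unique (suc zero) d uniq))))
        (reorder g d)))
      where
      reorder : ∀ g d → f′ (line zero d) + f′ (line (suc zero) d) ≡
                        f′ (line g d) + f′ (line (opposite g) d)
      reorder zero       d = refl
      reorder (suc zero) d = +-comm _ (f′ (line (suc zero) d))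

    -- Sort the blocks through `a` by colour: each of the `n` colours contributes `h`.
    ∑-mult : ∀ a → ∑ D (λ (c , B) → mult B a) ≡ n * h
    ∑-mult a = begin
      ∑ D (λ (c , B) → mult B a)
        ≡⟨ ∑-cong D (λ (c , B) → trans (sym (*-identityˡ _)) (cong (_* mult B a) (sym (∑-points c)))) ⟩
      ∑ D (λ (c , B) → ∑ points (λ c′ → ⟦ c′ ≟ᴬ c ⟧) * mult B a)
        ≡⟨ ∑-cong D (λ (c , B) → sym (∑-*ʳ points (mult B a) (λ c′ → ⟦ c′ ≟ᴬ c ⟧))) ⟩
      ∑ D (λ (c , B) → ∑ points (λ c′ → ⟦ c′ ≟ᴬ c ⟧ * mult B a))
        ≡⟨ ∑-swap D points (λ (c , B) c′ → ⟦ c′ ≟ᴬ c ⟧ * mult B a) ⟩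
      ∑ points (λ c′ → ∑ D (λ (c , B) → ⟦ c′ ≟ᴬ c ⟧ * mult B a))
        ≡⟨ ∑-cong points (λ c′ → colours c′ a) ⟩
      ∑ points (λ _ → h)
        ≡⟨ ∑-const points h ⟩
      length points * h
        ≡⟨ cong (_* h) length-points ⟩
      n * h ∎

    colourClass : A → ℕ
    colourClass c = ∑ D (λ (c′ , B) → ⟦ c ≟ᴬ c′ ⟧)

    -- Counting the incidences of one colour class in two ways gives five times its size on one side
    -- and `n * h` on the other; divisibility by 5 is thus a consequence of the class itself.
    colourClass-size : ∀ c → colourClass c ≡ (n * h) / 5
    colourClass-size c = trans (sym (m*n/n≡m (colourClass c) 5)) (cong (_/ 5) (begin
      colourClass c * 5
        ≡⟨ sym (∑-*ʳ D 5 (λ (c′ , B) → ⟦ c ≟ᴬ c′ ⟧)) ⟩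
      ∑ D (λ (c′ , B) → ⟦ c ≟ᴬ c′ ⟧ * 5)
        ≡⟨ ∑-cong-All proper (λ (c′ , B) (_ , len) → cong (⟦ c ≟ᴬ c′ ⟧ *_) (sym (trans (∑-points-mult B) len))) ⟩
      ∑ D (λ (c′ , B) → ⟦ c ≟ᴬ c′ ⟧ * ∑ points (mult B))
        ≡⟨ ∑-cong D (λ (c′ , B) → sym (∑-*ˡ points ⟦ c ≟ᴬ c′ ⟧ (mult B))) ⟩
      ∑ D (λ (c′ , B) → ∑ points (λ a → ⟦ c ≟ᴬ c′ ⟧ * mult B a))
        ≡⟨ ∑-swap D points (λ (c′ , B) a → ⟦ c ≟ᴬ c′ ⟧ * mult B a) ⟩
      ∑ points (λ a → ∑ D (λ (c′ , B) → ⟦ c ≟ᴬ c′ ⟧ * mult B a))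
        ≡⟨ ∑-cong points (colours c) ⟩
      ∑ points (λ _ → h)
        ≡⟨ ∑-const points h ⟩
      length points * h
        ≡⟨ cong (_* h) length-points ⟩
      n * h ∎))

    -- The first term counts the blocks in which the point belongs to the five-point part, the
    -- second those in which it is the colour.
    regular : ∀ v → replication blocks v ≡ n * h + (n * h) / 5
    regular v = go (point? v)
      where
      go : ∀ {v} → Point v → replication blocks v ≡ n * h + (n * h) / 5
      go (point g a) = begin
        replication blocks (pt g a)
          ≡⟨ length-filter (pt g a ∈ˢ?_) blocks ⟩
        ∑ blocks (λ B → ⟦ pt g a ∈ˢ? B ⟧)
          ≡⟨ ∑-blocks g _ (λ L → multˢ L (pt g a)) (λ uniq → ∈-toSubset uniq (pt g a)) ⟩
        ∑ D (λ d → multˢ (line g d) (pt g a) + multˢ (line (opposite g) d) (pt g a))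
          ≡⟨ ∑-cong D (λ (c , B) → cong₂ _+_ (mult-line-own g a c B) (mult-line-other g a c B)) ⟩
        ∑ D (λ (c , B) → mult B a + ⟦ a ≟ᴬ c ⟧)
          ≡⟨ ∑-+ D _ _ ⟩
        ∑ D (λ (c , B) → mult B a) + colourClass a
          ≡⟨ cong₂ _+_ (∑-mult a) (colourClass-size a) ⟩
        n * h + (n * h) / 5 ∎

    concurrence-∑ : ∀ g v w → concurrence blocks v w ≡
      ∑ D (λ d → multˢ (line g d) v * multˢ (line g d) w +
                 multˢ (line (opposite g) d) v * multˢ (line (opposite g) d) w)
    concurrence-∑ g v w = trans
      (length-filter (λ B → (v ∈ˢ? B) ×-dec (w ∈ˢ? B)) blocks)
      (∑-blocks g _ (λ L → multˢ L v * multˢ L w) (λ {L} uniq → trans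
        (⟦⟧-× (v ∈ˢ? toSubset L) (w ∈ˢ? toSubset L))
        (cong₂ _*_ (∈-toSubset uniq v) (∈-toSubset uniq w))))

    ⟦⟧-disjoint : ∀ {a b} → a ≢ b → ∀ c → ⟦ a ≟ᴬ c ⟧ * ⟦ b ≟ᴬ c ⟧ ≡ 0
    ⟦⟧-disjoint {a} {b} a≢b c = trans
      (sym (⟦⟧-× (a ≟ᴬ c) (b ≟ᴬ c)))
      (⟦⟧-false ((a ≟ᴬ c) ×-dec (b ≟ᴬ c)) (λ { (refl , refl) → a≢b refl }))

    -- A block has a single colour, so two distinct points of one group can only meet inside a
    -- five-point part.
    same-group : ∀ v w → v ≢ w → groupOf v ≡ groupOf w → concurrence blocks v w ≡ 2 * n
    same-group v w = go (point? v) (point? w)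
      where
      go : ∀ {v w} → Point v → Point w → v ≢ w → groupOf v ≡ groupOf w →
           concurrence blocks v w ≡ 2 * n
      go (point g a) (point k b) v≢w eq
        with refl ← trans (sym (groupOf-pt g a)) (trans eq (groupOf-pt k b)) = begin
        concurrence blocks (pt g a) (pt g b)
          ≡⟨ concurrence-∑ g (pt g a) (pt g b) ⟩
        ∑ D (λ d → multˢ (line g d) (pt g a) * multˢ (line g d) (pt g b) +
                   multˢ (line (opposite g) d) (pt g a) * multˢ (line (opposite g) d) (pt g b))
          ≡⟨ ∑-cong D (λ (c , B) → cong₂ _+_
               (cong₂ _*_ (mult-line-own g a c B) (mult-line-own g b c B))
               (trans (cong₂ _*_ (mult-line-other g a c B) (mult-line-other g b c B))
                      (⟦⟧-disjoint a≢b c))) ⟩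
        ∑ D (λ (c , B) → mult B a * mult B b + 0)
          ≡⟨ ∑-cong D (λ _ → +-identityʳ _) ⟩
        ∑ D (λ (c , B) → mult B a * mult B b)
          ≡⟨ pairs a b a≢b ⟩
        2 * n ∎
        where
        a≢b : a ≢ b
        a≢b = v≢w ∘ cong (pt g)

    opposite-unique : ∀ (g k : Fin 2) → g ≢ k → k ≡ opposite g
    opposite-unique zero       zero       g≢k = contradiction refl g≢k
    opposite-unique zero       (suc zero) g≢k = refl
    opposite-unique (suc zero) zero       g≢k = refl
    opposite-unique (suc zero) (suc zero) g≢k = contradiction refl g≢k

    -- Such points meet when `a` lies in a block coloured `b` or `b` in a block coloured `a`, and
    -- each happens `h` times.
    distinct-group : ∀ v w → groupOf v ≢ groupOf w → concurrence blocks v w ≡ n ∸ 1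
    distinct-group v w = go (point? v) (point? w)
      where
      go : ∀ {v w} → Point v → Point w → groupOf v ≢ groupOf w → concurrence blocks v w ≡ n ∸ 1
      go (point g a) (point k b) neq
        with refl ← opposite-unique g k
                      (λ g≡k → neq (trans (groupOf-pt g a) (trans g≡k (sym (groupOf-pt k b))))) = begin
        concurrence blocks (pt g a) (pt (opposite g) b)
          ≡⟨ concurrence-∑ g (pt g a) (pt (opposite g) b) ⟩
        ∑ D (λ d → multˢ (line g d) (pt g a) * multˢ (line g d) (pt (opposite g) b) +
                   multˢ (line (opposite g) d) (pt g a) * multˢ (line (opposite g) d) (pt (opposite g) b))
          ≡⟨ ∑-cong D (λ (c , B) → cong₂ _+_
               (cong₂ _*_ (mult-line-own g a c B)
                 (trans (cong (λ l → multˢ (line l (c , B)) (pt (opposite g) b)) (sym (opposite-involutive g)))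
                        (mult-line-other (opposite g) b c B)))
               (cong₂ _*_ (mult-line-other g a c B) (mult-line-own (opposite g) b c B))) ⟩
        ∑ D (λ (c , B) → mult B a * ⟦ b ≟ᴬ c ⟧ + ⟦ a ≟ᴬ c ⟧ * mult B b)
          ≡⟨ ∑-+ D _ _ ⟩
        ∑ D (λ (c , B) → mult B a * ⟦ b ≟ᴬ c ⟧) + ∑ D (λ (c , B) → ⟦ a ≟ᴬ c ⟧ * mult B b)
          ≡⟨ cong₂ _+_ (trans (∑-cong D (λ (c , B) → *-comm (mult B a) _)) (colours b a)) (colours a b) ⟩
        h + h
          ≡⟨ sym (m+n∸n≡m (h + h) 1) ⟩
        h + h + 1 ∸ 1
          ≡⟨ cong (_∸ 1) odd ⟩
        n ∸ 1 ∎

    All-blocks : ∀ {R : Subset (2 * n) → Set} →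
      (∀ g d → Unique (proj₂ d) → length (proj₂ d) ≡ 5 → R (toSubset (line g d))) → All R blocks
    All-blocks r = All.concat⁺ (All.map⁺ (All.map
      (λ {d} (uniq , len) → r zero d uniq len ∷ r (suc zero) d uniq len ∷ []) proper))

    design : GDD n 2 6 (2 * n) (n ∸ 1)
    design = record
      { groupOf        = groupOf
      ; blocks         = blocks
      ; r              = n * h + (n * h) / 5
      ; group-size     = size-fibre
      ; block-size     = All-blocks (λ g (c , B) uniq len → trans (∣toSubset∣ (line-unique g (c , B) uniq))
                           (cong suc (trans (length-map (pt g) B) len)))
      ; regular        = regular
      ; same-group     = same-group
      ; distinct-group = distinct-group
      }

    line∩fibre : ∀ g k d → Unique (proj₂ d) → length (proj₂ d) ≡ 5 →
      ∣ toSubset (line g d) ∩ fibre groupOf k ∣ ≡ ⟦ opposite g ≟ k ⟧ + 5 * ⟦ g ≟ k ⟧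
    line∩fibre g k d@(c , B) uniq len = trans
      (∣toSubset∩tabulate∣ (line-unique g d uniq) (λ v → does (groupOf v ≟ k)))
      (cong₂ _+_
        (cong (λ l → ⟦ l ≟ k ⟧) (groupOf-pt (opposite g) c))
        (begin
          ∑ (map (pt g) B) (λ v → ⟦ groupOf v ≟ k ⟧)    ≡⟨ ∑-map (pt g) B _ ⟩
          ∑ B (λ b → ⟦ groupOf (pt g b) ≟ k ⟧)          ≡⟨ ∑-cong B (λ b → cong (λ l → ⟦ l ≟ k ⟧) (groupOf-pt g b)) ⟩
          ∑ B (λ _ → ⟦ g ≟ k ⟧)                         ≡⟨ ∑-const B _ ⟩
          length B * ⟦ g ≟ k ⟧                          ≡⟨ cong (_* ⟦ g ≟ k ⟧) len ⟩
          5 * ⟦ g ≟ k ⟧                                 ∎))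

    configuration : HasConfiguration 1 5 design
    configuration = All-blocks λ where
      zero       d uniq len → inj₂ (line∩fibre zero zero d uniq len , line∩fibre zero (suc zero) d uniq len)
      (suc zero) d uniq len → inj₁ (line∩fibre (suc zero) zero d uniq len , line∩fibre (suc zero) (suc zero) d uniq len)

-- Arithmetic in ℤ/s for odd s

∑-involution : ∀ {n} (π : Fin n → Fin n) → (∀ i → π (π i) ≡ i) →
               ∀ f → ∑ (allFin n) (f ∘ π) ≡ ∑ (allFin n) f
∑-involution {n} π invol f = begin
  ∑ (allFin n) (f ∘ π)
    ≡⟨ ∑-cong (allFin n) (λ i → sym (∑-sift (π i) f)) ⟩
  ∑ (allFin n) (λ i → ∑ (allFin n) (λ j → ⟦ π i ≟ j ⟧ * f j))
    ≡⟨ ∑-swap (allFin n) (allFin n) (λ i j → ⟦ π i ≟ j ⟧ * f j) ⟩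
  ∑ (allFin n) (λ j → ∑ (allFin n) (λ i → ⟦ π i ≟ j ⟧ * f j))
    ≡⟨ ∑-cong (allFin n) (λ j → ∑-sift′ (λ i → π i ≟ j) (π j)
         (λ i eq → trans (cong π (sym eq)) (invol i)) (invol j) (λ _ → f j)) ⟩
  ∑ (allFin n) f ∎

∑-↑ : ∀ k {l} (f : Fin (k + l) → ℕ) →
      ∑ (allFin (k + l)) f ≡ ∑ (allFin k) (f ∘ (_↑ˡ l)) + ∑ (allFin l) (f ∘ (k ↑ʳ_))
∑-↑ zero    f = refl
∑-↑ (suc k) {l} f = begin
  ∑ (allFin (suc k + l)) f
    ≡⟨ ∑-allFin-suc f ⟩
  f zero + ∑ (allFin (k + l)) (f ∘ suc)
    ≡⟨ cong (f zero +_) (∑-↑ k (f ∘ suc)) ⟩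
  f zero + (∑ (allFin k) (f ∘ suc ∘ (_↑ˡ l)) + ∑ (allFin l) (f ∘ (suc k ↑ʳ_)))
    ≡⟨ sym (+-assoc (f zero) _ _) ⟩
  f zero + ∑ (allFin k) (f ∘ suc ∘ (_↑ˡ l)) + ∑ (allFin l) (f ∘ (suc k ↑ʳ_))
    ≡⟨ cong (_+ ∑ (allFin l) (f ∘ (suc k ↑ʳ_))) (sym (∑-allFin-suc (f ∘ (_↑ˡ l)))) ⟩
  ∑ (allFin (suc k)) (f ∘ (_↑ˡ l)) + ∑ (allFin l) (f ∘ (suc k ↑ʳ_)) ∎

data Coeff : Set where
  0ᶜ 1ᶜ -1ᶜ : Coeff

module Residues (m : ℕ) where

  s : ℕ
  s = suc (m + m)

  Z : Set
  Z = Fin s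

  0# : Z
  0# = zero

  infixl 6 _⊕_
  infix  8 ⊖_

  toℕ-mod : ∀ a → toℕ (a mod s) ≡ a % s
  toℕ-mod a = toℕ-fromℕ< (m%n<n a s)

  toℕ-% : ∀ (x : Z) → toℕ x % s ≡ toℕ x
  toℕ-% x = m<n⇒m%n≡m (toℕ<n x)

  mod-cong : ∀ {a b} → a % s ≡ b % s → a mod s ≡ b mod s
  mod-cong {a} {b} eq = toℕ-injective (trans (toℕ-mod a) (trans eq (sym (toℕ-mod b))))

  mod-toℕ : ∀ x → toℕ x mod s ≡ x
  mod-toℕ x = toℕ-injective (trans (toℕ-mod (toℕ x)) (toℕ-% x))

  abstract
    _⊕_ : Z → Z → Z
    x ⊕ y = (toℕ x + toℕ y) mod s

    ⊖_ : Z → Z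
    ⊖ x = (s ∸ toℕ x) mod s

    mod-⊕ : ∀ a b → (a mod s) ⊕ (b mod s) ≡ (a + b) mod s
    mod-⊕ a b = mod-cong {toℕ (a mod s) + toℕ (b mod s)} {a + b} (begin
      (toℕ (a mod s) + toℕ (b mod s)) % s ≡⟨ %-congˡ {o = s} (cong₂ _+_ (toℕ-mod a) (toℕ-mod b)) ⟩
      (a % s + b % s) % s                 ≡⟨ sym (%-distribˡ-+ a b s) ⟩
      (a + b) % s                         ∎)

    ⊕-comm : ∀ x y → x ⊕ y ≡ y ⊕ x
    ⊕-comm x y = cong (_mod s) (+-comm (toℕ x) (toℕ y))

    ⊕-assoc : ∀ x y z → (x ⊕ y) ⊕ z ≡ x ⊕ (y ⊕ z)
    ⊕-assoc x y z = begin
      (x ⊕ y) ⊕ z                              ≡⟨ cong ((x ⊕ y) ⊕_) (sym (mod-toℕ z)) ⟩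
      (x ⊕ y) ⊕ (toℕ z mod s)                  ≡⟨ mod-⊕ (toℕ x + toℕ y) (toℕ z) ⟩
      (toℕ x + toℕ y + toℕ z) mod s            ≡⟨ cong (_mod s) (+-assoc (toℕ x) (toℕ y) (toℕ z)) ⟩
      (toℕ x + (toℕ y + toℕ z)) mod s          ≡⟨ sym (mod-⊕ (toℕ x) (toℕ y + toℕ z)) ⟩
      (toℕ x mod s) ⊕ (y ⊕ z)                  ≡⟨ cong (_⊕ (y ⊕ z)) (mod-toℕ x) ⟩
      x ⊕ (y ⊕ z)                              ∎

    ⊕-identityˡ : ∀ x → 0# ⊕ x ≡ x
    ⊕-identityˡ = mod-toℕ

    ⊖-inverseˡ : ∀ x → (⊖ x) ⊕ x ≡ 0#
    ⊖-inverseˡ x = begin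
      (⊖ x) ⊕ x                      ≡⟨ cong ((⊖ x) ⊕_) (sym (mod-toℕ x)) ⟩
      (⊖ x) ⊕ (toℕ x mod s)          ≡⟨ mod-⊕ (s ∸ toℕ x) (toℕ x) ⟩
      (s ∸ toℕ x + toℕ x) mod s      ≡⟨ cong (_mod s) (m∸n+n≡m (<⇒≤ (toℕ<n x))) ⟩
      s mod s                        ≡⟨ mod-cong {s} {0} (n%n≡0 s) ⟩
      0 mod s                        ≡⟨ mod-toℕ 0# ⟩
      0#                             ∎

  Z-isAbelianGroup : IsAbelianGroup _≡_ _⊕_ 0# ⊖_
  Z-isAbelianGroup = record
    { isGroup = record
      { isMonoid = record
        { isSemigroup = record
          { isMagma = record { isEquivalence = isEquivalence ; ∙-cong = cong₂ _⊕_ }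
          ; assoc   = ⊕-assoc
          }
        ; identity = comm∧idˡ⇒id ⊕-comm ⊕-identityˡ
        }
      ; inverse = comm∧invˡ⇒inv ⊕-comm ⊖-inverseˡ
      ; ⁻¹-cong = cong ⊖_
      }
    ; comm = ⊕-comm
    }

  Z-abelianGroup : AbelianGroup _ _
  Z-abelianGroup = record { isAbelianGroup = Z-isAbelianGroup }

  open AbelianGroup Z-abelianGroup public
    using () renaming (identityʳ to ⊕-identityʳ; inverseʳ to ⊖-inverseʳ)
  open AbelianGroupProperties Z-abelianGroup public
    using () renaming ( ⁻¹-involutive to ⊖-involutive; ε⁻¹≈ε to ⊖-zero
                      ; ∙-cancelˡ to ⊕-cancelˡ; ∙-cancelʳ to ⊕-cancelʳ
                      ; inverseʳ-unique to ⊖-unique)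

  abstract
    -- Since 2 (m + 1) = s + 1, the factor `suc m` is the inverse of 2 modulo `s`.
    half : Z → Z
    half x = (suc m * toℕ x) mod s

    half-⊕ : ∀ x → half x ⊕ half x ≡ x
    half-⊕ x = begin
      half x ⊕ half x                              ≡⟨ mod-⊕ (suc m * toℕ x) (suc m * toℕ x) ⟩
      (suc m * toℕ x + suc m * toℕ x) mod s        ≡⟨ cong (_mod s) (double m (toℕ x)) ⟩
      (toℕ x + toℕ x * s) mod s                    ≡⟨ mod-cong {toℕ x + toℕ x * s} {toℕ x} ([m+kn]%n≡m%n (toℕ x) (toℕ x) s) ⟩
      toℕ x mod s                                  ≡⟨ mod-toℕ x ⟩
      x                                            ∎
      where
      double : ∀ m x → suc m * x + suc m * x ≡ x + x * suc (m + m)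
      double = solve 2 (λ m x → (con 1 :+ m) :* x :+ (con 1 :+ m) :* x :=
                                x :+ x :* (con 1 :+ (m :+ m))) refl
        where open +-*-Solver

    half-distrib : ∀ x y → half (x ⊕ y) ≡ half x ⊕ half y
    half-distrib x y = begin
      half (x ⊕ y)                                  ≡⟨ mod-* (suc m) (toℕ x + toℕ y) ⟩
      (suc m * (toℕ x + toℕ y)) mod s               ≡⟨ cong (_mod s) (*-distribˡ-+ (suc m) (toℕ x) (toℕ y)) ⟩
      (suc m * toℕ x + suc m * toℕ y) mod s         ≡⟨ sym (mod-⊕ (suc m * toℕ x) (suc m * toℕ y)) ⟩
      half x ⊕ half y                               ∎
      where
      mod-* : ∀ k a → (k * toℕ (a mod s)) mod s ≡ (k * a) mod s
      mod-* k a = mod-cong {k * toℕ (a mod s)} {k * a} (begin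
        (k * toℕ (a mod s)) % s            ≡⟨ %-distribˡ-* k (toℕ (a mod s)) s ⟩
        ((k % s) * (toℕ (a mod s) % s)) % s ≡⟨ %-congˡ {o = s} (cong ((k % s) *_) (trans (%-congˡ {o = s} (toℕ-mod a)) (m%n%n≡m%n a s))) ⟩
        ((k % s) * (a % s)) % s            ≡⟨ sym (%-distribˡ-* k a s) ⟩
        (k * a) % s                        ∎)

  -- Additivity of `half` turns the existence of halves into their uniqueness.
  double-half : ∀ x y → x ⊕ x ≡ y → half y ≡ x
  double-half x y refl = trans (half-distrib x x) (half-⊕ x)

  self-negative : ∀ x → x ≡ ⊖ x → x ≡ 0#
  self-negative x x≡⊖x = begin
    x           ≡⟨ sym (double-half x 0# (trans (cong (_⊕ x) x≡⊖x) (⊖-inverseˡ x))) ⟩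
    half 0#     ≡⟨ double-half 0# 0# (⊕-identityˡ 0#) ⟩
    0#          ∎

  infixr 7 _·_
  _·_ : Coeff → Z → Z
  0ᶜ  · x = 0#
  1ᶜ  · x = x
  -1ᶜ · x = ⊖ x

  ·-zero : ∀ a → a · 0# ≡ 0#
  ·-zero 0ᶜ  = refl
  ·-zero 1ᶜ  = refl
  ·-zero -1ᶜ = ⊖-zero

  ⊕-⊖-cancelʳ : ∀ x y → x ⊕ y ⊕ ⊖ y ≡ x
  ⊕-⊖-cancelʳ x y = trans (⊕-assoc x y (⊖ y)) (trans (cong (x ⊕_) (⊖-inverseʳ y)) (⊕-identityʳ x))

  ⊖-⊕-cancelʳ : ∀ x y → x ⊕ ⊖ y ⊕ y ≡ x
  ⊖-⊕-cancelʳ x y = trans (⊕-assoc x (⊖ y) y) (trans (cong (x ⊕_) (⊖-inverseˡ y)) (⊕-identityʳ x))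

  ⊕-⊖-solve : ∀ {x y z} → x ⊕ y ≡ z → x ≡ z ⊕ ⊖ y
  ⊕-⊖-solve {x} {y} eq = trans (sym (⊕-⊖-cancelʳ x y)) (cong (_⊕ ⊖ y) eq)

  -- The coefficients differ by ±1 or ±2, which are units since s is odd.
  linear-solution : ∀ {a b} → a ≢ b → ∀ c d →
    ∃ λ x₀ → (∀ x → c ⊕ a · x ≡ d ⊕ b · x → x₀ ≡ x) × (c ⊕ a · x₀ ≡ d ⊕ b · x₀)
  linear-solution {0ᶜ}  {0ᶜ}  a≢b c d = contradiction refl a≢b
  linear-solution {1ᶜ}  {1ᶜ}  a≢b c d = contradiction refl a≢b
  linear-solution { -1ᶜ} { -1ᶜ} a≢b c d = contradiction refl a≢b
  linear-solution {0ᶜ}  {1ᶜ}  a≢b c d = c ⊕ ⊖ d ,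
    (λ x eq → sym (⊕-⊖-solve (trans (⊕-comm x d) (trans (sym eq) (⊕-identityʳ c))))) ,
    trans (⊕-identityʳ c) (trans (sym (⊖-⊕-cancelʳ c d)) (⊕-comm _ d))
  linear-solution {0ᶜ}  { -1ᶜ} a≢b c d = d ⊕ ⊖ c ,
    (λ x eq → sym (⊕-⊖-solve (trans (⊕-comm x c) (trans (cong (_⊕ x) (trans (sym (⊕-identityʳ c)) eq)) (⊖-⊕-cancelʳ d x))))) ,
    trans (⊕-identityʳ c) (sym (trans (cong (_⊕ ⊖ (d ⊕ ⊖ c)) (trans (sym (⊖-⊕-cancelʳ d c)) (⊕-comm _ c))) (⊕-⊖-cancelʳ c (d ⊕ ⊖ c))))
  linear-solution {1ᶜ}  { -1ᶜ} a≢b c d = half (d ⊕ ⊖ c) ,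
    (λ x eq → double-half x (d ⊕ ⊖ c) (⊕-⊖-solve (begin
      x ⊕ x ⊕ c           ≡⟨ trans (⊕-comm (x ⊕ x) c) (sym (⊕-assoc c x x)) ⟩
      c ⊕ x ⊕ x           ≡⟨ cong (_⊕ x) eq ⟩
      d ⊕ ⊖ x ⊕ x         ≡⟨ ⊖-⊕-cancelʳ d x ⟩
      d                   ∎))) ,
    (let y = half (d ⊕ ⊖ c) in ⊕-⊖-solve (begin
      c ⊕ y ⊕ y           ≡⟨ ⊕-assoc c y y ⟩
      c ⊕ (y ⊕ y)         ≡⟨ cong (c ⊕_) (half-⊕ (d ⊕ ⊖ c)) ⟩
      c ⊕ (d ⊕ ⊖ c)       ≡⟨ ⊕-comm c _ ⟩
      d ⊕ ⊖ c ⊕ c         ≡⟨ ⊖-⊕-cancelʳ d c ⟩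
      d                   ∎))
  linear-solution {1ᶜ}  {0ᶜ}  a≢b c d with linear-solution {0ᶜ} {1ᶜ} (λ ()) d c
  ... | x₀ , uniq , sol = x₀ , (λ x → uniq x ∘ sym) , sym sol
  linear-solution { -1ᶜ} {0ᶜ} a≢b c d with linear-solution {0ᶜ} { -1ᶜ} (λ ()) d c
  ... | x₀ , uniq , sol = x₀ , (λ x → uniq x ∘ sym) , sym sol
  linear-solution { -1ᶜ} {1ᶜ} a≢b c d with linear-solution {1ᶜ} { -1ᶜ} (λ ()) d c
  ... | x₀ , uniq , sol = x₀ , (λ x → uniq x ∘ sym) , sym sol

  elements : List Z
  elements = allFin s

  ∑-linear : ∀ {a b} → a ≢ b → ∀ c d → ∑ elements (λ x → ⟦ c ⊕ a · x ≟ d ⊕ b · x ⟧) ≡ 1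
  ∑-linear {a} {b} a≢b c d with linear-solution a≢b c d
  ... | x₀ , uniq , sol = ∑-unique (λ x → c ⊕ a · x ≟ d ⊕ b · x) x₀ uniq sol

  ∑-translate : ∀ z f → ∑ elements (λ t → ⟦ z ≟ t ⊕ f ⟧) ≡ 1
  ∑-translate z f = ∑-unique (λ t → z ≟ t ⊕ f) (z ⊕ ⊖ f)
    (λ t eq → sym (⊕-⊖-solve (sym eq))) (sym (⊖-⊕-cancelʳ z f))

  -- The first condition determines the translation `t`; substituting it in the second leaves one
  -- equation without `t`, arranged without negation in the form that `linear-solution` solves.
  ∑-translates : ∀ z z′ f f′ →
    ∑ elements (λ t → ⟦ z ≟ t ⊕ f ⟧ * ⟦ z′ ≟ t ⊕ f′ ⟧) ≡ ⟦ z′ ⊕ f ≟ z ⊕ f′ ⟧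
  ∑-translates z z′ f f′ = trans
    (∑-sift′ (λ t → z ≟ t ⊕ f) (z ⊕ ⊖ f)
      (λ t eq → sym (⊕-⊖-solve (sym eq))) (sym (⊖-⊕-cancelʳ z f))
      (λ t → ⟦ z′ ≟ t ⊕ f′ ⟧))
    (⟦⟧-cong
      (λ eq → trans (cong (_⊕ f) eq) swap)
      (λ eq → ⊕-cancelʳ f _ _ (trans eq (sym swap)))
      (z′ ≟ z ⊕ ⊖ f ⊕ f′) (z′ ⊕ f ≟ z ⊕ f′))
    where
    swap : z ⊕ ⊖ f ⊕ f′ ⊕ f ≡ z ⊕ f′
    swap = begin
      z ⊕ ⊖ f ⊕ f′ ⊕ f     ≡⟨ ⊕-assoc (z ⊕ ⊖ f) f′ f ⟩
      z ⊕ ⊖ f ⊕ (f′ ⊕ f)   ≡⟨ cong (z ⊕ ⊖ f ⊕_) (⊕-comm f′ f) ⟩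
      z ⊕ ⊖ f ⊕ (f ⊕ f′)   ≡⟨ sym (⊕-assoc (z ⊕ ⊖ f) f f′) ⟩
      z ⊕ ⊖ f ⊕ f ⊕ f′     ≡⟨ cong (_⊕ f′) (⊖-⊕-cancelʳ z f) ⟩
      z ⊕ f′               ∎

  -- One element from each pair {y, -y} with y nonzero.
  halfSystem : List Z
  halfSystem = tabulate {n = m} (λ i → suc (i ↑ˡ m))

  halfSystem-≢0 : All (_≢ 0#) halfSystem
  halfSystem-≢0 = All.tabulate⁺ (λ _ ())

  abstract
    -- Negation carries 1, ..., m to m + 1, ..., 2m in reverse order, so the half system and its
    -- negatives exhaust the nonzero residues.
    ⊖-suc-↑ˡ : ∀ i → ⊖ suc (i ↑ˡ m) ≡ suc (m ↑ʳ opposite i)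
    ⊖-suc-↑ˡ i = sym (⊖-unique (suc (i ↑ˡ m)) (suc (m ↑ʳ opposite i)) (begin
      suc (i ↑ˡ m) ⊕ suc (m ↑ʳ opposite i)
        ≡⟨ cong (_mod s) total ⟩
      s mod s
        ≡⟨ mod-cong {s} {0} (n%n≡0 s) ⟩
      0 mod s
        ≡⟨ mod-toℕ 0# ⟩
      0# ∎))
      where
      total : toℕ (suc (i ↑ˡ m)) + toℕ (suc (m ↑ʳ opposite i)) ≡ s
      total = begin
        suc (toℕ (i ↑ˡ m)) + suc (toℕ (m ↑ʳ opposite i))
          ≡⟨ cong₂ (λ a b → suc a + suc b) (toℕ-↑ˡ i m) (trans (toℕ-↑ʳ m (opposite i)) (cong (m +_) (opposite-prop i))) ⟩
        suc (toℕ i) + suc (m + (m ∸ suc (toℕ i)))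
          ≡⟨ rearrange (suc (toℕ i)) m (m ∸ suc (toℕ i)) ⟩
        suc (m + (m ∸ suc (toℕ i) + suc (toℕ i)))
          ≡⟨ cong (λ a → suc (m + a)) (m∸n+n≡m (toℕ<n i)) ⟩
        s ∎
        where
        rearrange : ∀ a b c → a + suc (b + c) ≡ suc (b + (c + a))
        rearrange = solve 3 (λ a b c → a :+ (con 1 :+ (b :+ c)) := con 1 :+ (b :+ (c :+ a))) refl
          where open +-*-Solver

  -- The bridge from half systems, where blocks live, to full sums, where linear equations have
  -- exactly one solution.
  ∑-even : ∀ (g : Z → ℕ) → (∀ y → g (⊖ y) ≡ g y) →
           ∑ elements g ≡ g 0# + (∑ halfSystem g + ∑ halfSystem g)
  ∑-even g even = begin
    ∑ elements g
      ≡⟨ ∑-allFin-suc g ⟩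
    g 0# + ∑ (allFin (m + m)) (g ∘ suc)
      ≡⟨ cong (g 0# +_) (∑-↑ m (g ∘ suc)) ⟩
    g 0# + (∑ (allFin m) (λ i → g (suc (i ↑ˡ m))) + ∑ (allFin m) (λ i → g (suc (m ↑ʳ i))))
      ≡⟨ cong (g 0# +_) (cong₂ _+_ (sym (∑-tabulate (λ i → suc (i ↑ˡ m)) g)) (begin
           ∑ (allFin m) (λ i → g (suc (m ↑ʳ i)))
             ≡⟨ sym (∑-involution opposite opposite-involutive (λ i → g (suc (m ↑ʳ i)))) ⟩
           ∑ (allFin m) (λ i → g (suc (m ↑ʳ opposite i)))
             ≡⟨ ∑-cong (allFin m) (λ i → trans (cong g (sym (⊖-suc-↑ˡ i))) (even _)) ⟩
           ∑ (allFin m) (λ i → g (suc (i ↑ˡ m)))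
             ≡⟨ sym (∑-tabulate (λ i → suc (i ↑ˡ m)) g) ⟩
           ∑ halfSystem g ∎)) ⟩
    g 0# + (∑ halfSystem g + ∑ halfSystem g) ∎

-- Symbolic counts as polynomials in s

_≟ᶜ_ : DecidableEquality Coeff
0ᶜ  ≟ᶜ 0ᶜ  = yes refl
0ᶜ  ≟ᶜ 1ᶜ  = no λ ()
0ᶜ  ≟ᶜ -1ᶜ = no λ ()
1ᶜ  ≟ᶜ 0ᶜ  = no λ ()
1ᶜ  ≟ᶜ 1ᶜ  = yes refl
1ᶜ  ≟ᶜ -1ᶜ = no λ ()
-1ᶜ ≟ᶜ 0ᶜ  = no λ ()
-1ᶜ ≟ᶜ 1ᶜ  = no λ ()
-1ᶜ ≟ᶜ -1ᶜ = yes refl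

-- Polynomials in s of degree at most two, by their coefficients.
Poly : Set
Poly = Vec ℕ 3

dot : ∀ {k} → Vec ℕ k → Vec ℕ k → ℕ
dot []       []       = 0
dot (x ∷ xs) (y ∷ ys) = x * y + dot xs ys

dot-zipWith : ∀ {k} (xs ys zs : Vec ℕ k) → dot (Vec.zipWith _+_ xs ys) zs ≡ dot xs zs + dot ys zs
dot-zipWith []       []       []       = refl
dot-zipWith (x ∷ xs) (y ∷ ys) (z ∷ zs) = trans
  (cong₂ _+_ (*-distribʳ-+ z x y) (dot-zipWith xs ys zs))
  (+-interchange (x * z) (y * z) (dot xs zs) (dot ys zs))

dot-zero : ∀ {k} (zs : Vec ℕ k) → dot (replicate k 0) zs ≡ 0
dot-zero []       = refl
dot-zero (z ∷ zs) = dot-zero zs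

basis : ∀ {k} → Fin k → Vec ℕ k
basis zero    = 1 ∷ replicate _ 0
basis (suc i) = 0 ∷ basis i

dot-basis : ∀ {k} (i : Fin k) (zs : Vec ℕ k) → dot (basis i) zs ≡ lookup zs i
dot-basis zero    (z ∷ zs) = trans (cong₂ _+_ (*-identityˡ z) (dot-zero zs)) (+-identityʳ z)
dot-basis (suc i) (z ∷ zs) = dot-basis i zs

-- (U , V) stands for U(s) + V(s) [z = z′].
Count : Set
Count = Poly × Poly

0ⁿ : Count
0ⁿ = replicate 3 0 , replicate 3 0

infixl 6 _⊞_
_⊞_ : Count → Count → Count
(U , V) ⊞ (U′ , V′) = Vec.zipWith _+_ U U′ , Vec.zipWith _+_ V V′

uniform diagonal : Fin 3 → Count
uniform  k = basis k , replicate 3 0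
diagonal k = replicate 3 0 , basis k

⟪_⟫ : Count → ℕ → ℕ → ℕ
⟪ U , V ⟫ s δ = dot U (1 ∷ s ∷ s * s ∷ []) + dot V (1 ∷ s ∷ s * s ∷ []) * δ

⟪⊞⟫ : ∀ c c′ s δ → ⟪ c ⊞ c′ ⟫ s δ ≡ ⟪ c ⟫ s δ + ⟪ c′ ⟫ s δ
⟪⊞⟫ (U , V) (U′ , V′) s δ = trans
  (cong₂ _+_ (dot-zipWith U U′ _) (trans (cong (_* δ) (dot-zipWith V V′ _)) (*-distribʳ-+ δ (dot V _) (dot V′ _))))
  (+-interchange (dot U _) (dot U′ _) _ _)

⟪uniform⟫ : ∀ k s δ → ⟪ uniform k ⟫ s δ ≡ lookup (1 ∷ s ∷ s * s ∷ []) k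
⟪uniform⟫ k s δ = trans (+-identityʳ _) (dot-basis k _)

⟪diagonal⟫ : ∀ k s δ → ⟪ diagonal k ⟫ s δ ≡ lookup (1 ∷ s ∷ s * s ∷ []) k * δ
⟪diagonal⟫ k s δ = cong (_* δ) (dot-basis k (1 ∷ s ∷ s * s ∷ []))

∑ⁿ : {A : Set} → List A → (A → Count) → Count
∑ⁿ []       f = 0ⁿ
∑ⁿ (x ∷ xs) f = f x ⊞ ∑ⁿ xs f

⟪∑ⁿ⟫ : ∀ {A : Set} (xs : List A) f s δ → ⟪ ∑ⁿ xs f ⟫ s δ ≡ ∑ xs (λ x → ⟪ f x ⟫ s δ)
⟪∑ⁿ⟫ []       f s δ = refl
⟪∑ⁿ⟫ (x ∷ xs) f s δ = trans (⟪⊞⟫ (f x) (∑ⁿ xs f) s δ) (cong (⟪ f x ⟫ s δ +_) (⟪∑ⁿ⟫ xs f s δ))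

-- Base blocks with symbolic coefficients and a decidable criterion for them

module Templates (u w : ℕ) where

  Location : Set
  Location = Fin u ⊎ Fin w

  -- Comparison through ℕ, because good? is decided by evaluation.
  _≟ˡ_ : DecidableEquality Location
  _≟ˡ_ = Sum.≡-dec _≟ᵗ_ _≟ᵗ_
    where
    _≟ᵗ_ : ∀ {k} → DecidableEquality (Fin k)
    i ≟ᵗ j = map′ toℕ-injective (cong toℕ) (toℕ i ℕ.≟ toℕ j)

  Entry : Set
  Entry = Location × Coeff × Coeff

  Template : Set
  Template = List Entry

  Shape : Set
  Shape = Fin w × Fin w × Fin w

  -- At x = 0 a crossed block would contain a point twice. The doubled block uses y in both copies
  -- instead, so it keeps the 2 + 2 + 1 distribution over copies and still has five points for every
  -- y other than 0.
  crossed doubled : Shape → Template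
  crossed (i , j , l) = (inj₂ i , 1ᶜ , 0ᶜ) ∷ (inj₂ i , -1ᶜ , 0ᶜ) ∷
                        (inj₂ j , 0ᶜ , 1ᶜ) ∷ (inj₂ j , 0ᶜ , -1ᶜ) ∷ (inj₂ l , 0ᶜ , 0ᶜ) ∷ []
  doubled (i , j , l) = (inj₂ i , 0ᶜ , 1ᶜ) ∷ (inj₂ i , 0ᶜ , -1ᶜ) ∷
                        (inj₂ j , 0ᶜ , 1ᶜ) ∷ (inj₂ j , 0ᶜ , -1ᶜ) ∷ (inj₂ l , 0ᶜ , 0ᶜ) ∷ []

  -- The base blocks of the colours (e , x), x ∈ ℤ/s: crossed shapes if x ≠ 0 and
  -- doubled shapes if x = 0, both for y in a half system; planes, for all y; and
  -- lines, for y = 0.  For a fixed point as colour, x is 0.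
  record Bundle : Set where
    field
      crossedShapes doubledShapes : List Shape
      planes lines : List Template

    crossedTemplates doubledTemplates : List Template
    crossedTemplates = map crossed crossedShapes
    doubledTemplates = map doubled doubledShapes

  open Bundle public

  occurrences : Location → List Template → ℕ
  occurrences ℓ Bs = ∑ Bs (λ B → ∑ B (λ e → ⟦ ℓ ≟ˡ proj₁ e ⟧))

  Transversal : Template → Set
  Transversal B = Unique (map proj₁ B) × length B ≡ 5

  Distinct : Shape → Set
  Distinct (i , j , l) = i ≢ j × i ≢ l × j ≢ l

  -- Each colour class covers each point (n - 1)/2 times, read off coefficientwise in s.
  Balanced : Bundle → Location → Set
  Balanced b ℓ@(inj₁ _) =
    occurrences ℓ (crossedTemplates b) ≡ 0 × occurrences ℓ (doubledTemplates b) ≡ 0 ×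
    occurrences ℓ (planes b) ≡ 0 × 2 * occurrences ℓ (lines b) ≡ w × u ≡ 1
  Balanced b ℓ@(inj₂ _) =
    occurrences ℓ (doubledTemplates b) ≡ occurrences ℓ (crossedTemplates b) ×
    occurrences ℓ (crossedTemplates b) + 2 * occurrences ℓ (planes b) ≡ w ×
    2 * occurrences ℓ (lines b) + 1 ≡ u + occurrences ℓ (crossedTemplates b)

  Valid : Bundle → Set
  Valid b = All Distinct (crossedShapes b) × All Distinct (doubledShapes b) ×
            All Transversal (planes b) × All Transversal (lines b) ×
            (∀ f → Balanced b (inj₁ f)) × (∀ i → Balanced b (inj₂ i))

  valid? : ∀ b → Dec (Valid b)
  valid? b = All.all? distinct? (crossedShapes b) ×-dec All.all? distinct? (doubledShapes b) ×-dec
             All.all? transversal? (planes b) ×-dec All.all? transversal? (lines b) ×-dec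
             all? (balanced? ∘ inj₁) ×-dec all? (balanced? ∘ inj₂)
    where
    distinct? : Decidable Distinct
    distinct? (i , j , l) = ¬? (i ≟ j) ×-dec ¬? (i ≟ l) ×-dec ¬? (j ≟ l)

    transversal? : Decidable Transversal
    transversal? B = DecUnique.unique? _≟ˡ_ (map proj₁ B) ×-dec (length B ℕ.≟ 5)

    balanced? : ∀ ℓ → Dec (Balanced b ℓ)
    balanced? ℓ@(inj₁ _) = (occurrences ℓ (crossedTemplates b) ℕ.≟ 0) ×-dec
      (occurrences ℓ (doubledTemplates b) ℕ.≟ 0) ×-dec (occurrences ℓ (planes b) ℕ.≟ 0) ×-dec
      (2 * occurrences ℓ (lines b) ℕ.≟ w) ×-dec (u ℕ.≟ 1)
    balanced? ℓ@(inj₂ _) = (occurrences ℓ (doubledTemplates b) ℕ.≟ occurrences ℓ (crossedTemplates b)) ×-dec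
      (occurrences ℓ (crossedTemplates b) + 2 * occurrences ℓ (planes b) ℕ.≟ w) ×-dec
      (2 * occurrences ℓ (lines b) + 1 ℕ.≟ u + occurrences ℓ (crossedTemplates b))

  -- Which of the parameters x, y of a template run through all residues; the others are 0.
  data Range : Set where
    xy-range x-range y-range no-range : Range

  dimension : Range → Fin 3
  dimension xy-range = suc (suc zero)
  dimension x-range  = suc zero
  dimension y-range  = suc zero
  dimension no-range = zero

  -- The number of parameters and translations for which two entries become two given moving points.
  -- After elimination of the translation one linear equation remains. If the coefficients of the
  -- running parameters agree, it reads z = z′ and each parameter value counts; otherwise it
  -- determines one parameter and costs one factor s.
  meetings : Range → Coeff × Coeff → Coeff × Coeff → Count
  meetings xy-range (a , b) (a′ , b′) =
    if does (a ≟ᶜ a′) ∧ does (b ≟ᶜ b′) then diagonal (suc (suc zero)) else uniform (suc zero)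
  meetings x-range  (a , b) (a′ , b′) = if does (a ≟ᶜ a′) then diagonal (suc zero) else uniform zero
  meetings y-range  (a , b) (a′ , b′) = if does (b ≟ᶜ b′) then diagonal (suc zero) else uniform zero
  meetings no-range _       _         = diagonal zero

  -- Translations do not move a fixed point, so its moving partner alone determines the translation,
  -- once for each value of the parameters.
  weights : Range → Location → Coeff × Coeff → Coeff × Coeff → Count
  weights ρ (inj₁ _) _ _  = uniform (dimension ρ)
  weights ρ (inj₂ _) c c′ = meetings ρ c c′

  coefficients : Location → Template → List (Coeff × Coeff)
  coefficients ℓ B = map proj₂ (filter (λ e → ℓ ≟ˡ proj₁ e) B)

  count : Range → List Template → Location → Location → Count
  count ρ Bs ℓ ℓ′ = ∑ⁿ Bs (λ B → ∑ⁿ (coefficients ℓ B) (λ c → ∑ⁿ (coefficients ℓ′ B) (weights ρ ℓ c)))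

  record Spec : Set where
    field
      bundle : Fin w → Bundle
      extra  : Fin u → Bundle

  open Spec public

  twice : Count → Count
  twice c = c ⊞ c

  -- Doubling replaces sums over a half system by sums over all y, up to the terms
  -- with y = 0: twice the number of blocks through a pair, plus excess, is full.
  excess full extraExcess extraFull : Bundle → Location → Location → Count
  excess b ℓ ℓ′ = count y-range (crossedTemplates b) ℓ ℓ′ ⊞ count x-range (crossedTemplates b) ℓ ℓ′ ⊞
                  count no-range (doubledTemplates b) ℓ ℓ′
  full b ℓ ℓ′ = count y-range (doubledTemplates b) ℓ ℓ′ ⊞ count xy-range (crossedTemplates b) ℓ ℓ′ ⊞
                count no-range (crossedTemplates b) ℓ ℓ′ ⊞
                twice (count xy-range (planes b) ℓ ℓ′ ⊞ count x-range (lines b) ℓ ℓ′)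
  extraExcess b ℓ ℓ′ = count no-range (doubledTemplates b) ℓ ℓ′
  extraFull b ℓ ℓ′ = count y-range (doubledTemplates b) ℓ ℓ′ ⊞
                     twice (count y-range (planes b) ℓ ℓ′ ⊞ count no-range (lines b) ℓ ℓ′)

  totalExcess totalFull : Spec → Location → Location → Count
  totalExcess σ ℓ ℓ′ = ∑ⁿ (allFin w) (λ e → excess (bundle σ e) ℓ ℓ′) ⊞
                       ∑ⁿ (allFin u) (λ f → extraExcess (extra σ f) ℓ ℓ′)
  totalFull   σ ℓ ℓ′ = ∑ⁿ (allFin w) (λ e → full (bundle σ e) ℓ ℓ′) ⊞
                       ∑ⁿ (allFin u) (λ f → extraFull (extra σ f) ℓ ℓ′)

  -- Counts are doubled throughout, so each pair should be covered 4n = 4u + 4ws times, whether or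
  -- not the residues agree.
  target : Count
  target = (4 * u ∷ 4 * w ∷ 0 ∷ []) , replicate 3 0

  -- Distinct points of one copy have distinct residues, so there only U matters, while V also
  -- collects every entry paired with itself. Points of different copies may have equal or distinct
  -- residues, so there both polynomials must match.
  Uniform Covered : Spec → Location → Location → Set
  Uniform σ ℓ ℓ′ = proj₁ (totalFull σ ℓ ℓ′) ≡ proj₁ (totalExcess σ ℓ ℓ′ ⊞ target)
  Covered σ ℓ ℓ′ = (ℓ ≡ ℓ′ × Uniform σ ℓ ℓ′) ⊎ totalFull σ ℓ ℓ′ ≡ totalExcess σ ℓ ℓ′ ⊞ target

  Good : Spec → Set
  Good σ = (∀ e → Valid (bundle σ e)) × (∀ f → Valid (extra σ f)) ×
           -- There is at most one fixed point, hence no pair of fixed points to cover.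
           (∀ (f f′ : Fin u) → f ≡ f′) ×
           (∀ f i → Uniform σ (inj₁ f) (inj₂ i)) × (∀ i j → i ≤ j → Covered σ (inj₂ i) (inj₂ j))

  good? : ∀ σ → Dec (Good σ)
  good? σ = all? (λ e → valid? (bundle σ e)) ×-dec all? (λ f → valid? (extra σ f)) ×-dec
            all? (λ f → all? (λ f′ → f ≟ f′)) ×-dec
            all? (λ f → all? (λ i → uniform? (inj₁ f) (inj₂ i))) ×-dec
            all? (λ i → all? (λ j → (i ≤? j) →-dec covered? (inj₂ i) (inj₂ j)))
    where
    _≟ᵖ_ : DecidableEquality Poly
    _≟ᵖ_ = Vec.≡-dec ℕ._≟_

    uniform? : ∀ ℓ ℓ′ → Dec (Uniform σ ℓ ℓ′)
    uniform? ℓ ℓ′ = proj₁ (totalFull σ ℓ ℓ′) ≟ᵖ proj₁ (totalExcess σ ℓ ℓ′ ⊞ target)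

    covered? : ∀ ℓ ℓ′ → Dec (Covered σ ℓ ℓ′)
    covered? ℓ ℓ′ = ((ℓ ≟ˡ ℓ′) ×-dec uniform? ℓ ℓ′) ⊎-dec
      Product.≡-dec _≟ᵖ_ _≟ᵖ_ (totalFull σ ℓ ℓ′) (totalExcess σ ℓ ℓ′ ⊞ target)

-- Realisation over ℤ/s: proper blocks and balanced colour classes

All-concatMap : {A B : Set} {P : A → Set} {Q : B → Set} {f : A → List B} {xs : List A} →
                All P xs → (∀ {x} → P x → All Q (f x)) → All Q (concatMap f xs)
All-concatMap ps h = All.concat⁺ (All.map⁺ (All.map h ps))

module Realisation (u w m : ℕ) where

  open Templates u w
  open Residues m

  Pt : Set
  Pt = Fin u ⊎ (Fin w × Z)

  _≟ᴾ_ : DecidableEquality Pt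
  _≟ᴾ_ = Sum.≡-dec _≟_ (Product.≡-dec _≟_ _≟_)

  open Multiplicity _≟ᴾ_

  encode : Pt → Fin (u + w * s)
  encode p = join u (w * s) (Sum.map₂ (uncurry combine) p)

  decode : Fin (u + w * s) → Pt
  decode i = Sum.map₂ (remQuot s) (splitAt u i)

  decode-encode : ∀ p → decode (encode p) ≡ p
  decode-encode p = trans (cong (Sum.map₂ (remQuot s)) (splitAt-join u (w * s) (Sum.map₂ (uncurry combine) p))) (back p)
    where
    back : ∀ p → Sum.map₂ (remQuot s) (Sum.map₂ (uncurry combine) p) ≡ p
    back (inj₁ f)       = refl
    back (inj₂ (i , z)) = cong inj₂ (remQuot-combine i z)

  encode-decode : ∀ i → encode (decode i) ≡ i
  encode-decode i = trans (cong (join u (w * s)) (back (splitAt u i))) (join-splitAt u (w * s) i)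
    where
    back : ∀ j → Sum.map₂ (uncurry combine) (Sum.map₂ (remQuot {w} s) j) ≡ j
    back (inj₁ f) = refl
    back (inj₂ j) = cong inj₂ (combine-remQuot {w} s j)

  location : Pt → Location
  location (inj₁ f)       = inj₁ f
  location (inj₂ (i , z)) = inj₂ i

  place : Z → Z → Z → Entry → Pt
  place t x y (inj₁ f , _)     = inj₁ f
  place t x y (inj₂ i , a , b) = inj₂ (i , t ⊕ (a · x ⊕ b · y))

  location-place : ∀ t x y e → location (place t x y e) ≡ proj₁ e
  location-place t x y (inj₁ f , _)     = refl
  location-place t x y (inj₂ i , a , b) = refl

  realise : Template → Z → Z → Z → List Pt
  realise B t x y = map (place t x y) B

  pairTemplates : Bundle → Z → List Template
  pairTemplates b zero    = doubledTemplates b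
  pairTemplates b (suc _) = crossedTemplates b

  develop : Bundle → Z → List (List Pt)
  develop b x = concatMap (λ t →
    concatMap (λ B → map (realise B t x) halfSystem) (pairTemplates b x) ++
    concatMap (λ B → map (realise B t x) elements) (planes b) ++
    map (λ B → realise B t x 0#) (lines b)) elements

  colouredBlocks : Spec → List (Pt × List Pt)
  colouredBlocks σ =
    concatMap (λ e → concatMap (λ x → map (inj₂ (e , x) ,_) (develop (bundle σ e) x)) elements) (allFin w) ++
    concatMap (λ f → map (inj₁ f ,_) (develop (extra σ f) 0#)) (allFin u)

  -- Blocks have five distinct points

  -- The points lie in pairwise different locations, so they stay distinct whatever the parameters.
  transversal-realise : ∀ {B} → Transversal B → ∀ t x y →
                        Unique (realise B t x y) × length (realise B t x y) ≡ 5
  transversal-realise {B} (uniq , len) t x y =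
    Unique.map⁻ (subst Unique locations uniq) ,
    trans (length-map (place t x y) B) len
    where
    locations : map proj₁ B ≡ map location (realise B t x y)
    locations = trans (map-cong (λ e → sym (location-place t x y e)) B) (map-∘ B)

  ⊕-≢ : ∀ t {f f′} → f ≢ f′ → t ⊕ f ≢ t ⊕ f′
  ⊕-≢ t f≢f′ = f≢f′ ∘ ⊕-cancelˡ t _ _

  ·-≢ : ∀ {y} → y ≢ 0# → y ≢ ⊖ y
  ·-≢ y≢0 = y≢0 ∘ self-negative _

  pair-unique : ∀ {i j l : Fin w} {z₁ z₂ z₃ z₄ z₅ : Z} → Distinct (i , j , l) → z₁ ≢ z₂ → z₃ ≢ z₄ →
    Unique {A = Pt} (inj₂ (i , z₁) ∷ inj₂ (i , z₂) ∷ inj₂ (j , z₃) ∷ inj₂ (j , z₄) ∷ inj₂ (l , z₅) ∷ [])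
  pair-unique (i≢j , i≢l , j≢l) z₁≢z₂ z₃≢z₄ =
    ((λ { refl → z₁≢z₂ refl }) ∷ (λ { refl → i≢j refl }) ∷ (λ { refl → i≢j refl }) ∷ (λ { refl → i≢l refl }) ∷ []) ∷
    ((λ { refl → i≢j refl }) ∷ (λ { refl → i≢j refl }) ∷ (λ { refl → i≢l refl }) ∷ []) ∷
    ((λ { refl → z₃≢z₄ refl }) ∷ (λ { refl → j≢l refl }) ∷ []) ∷
    ((λ { refl → j≢l refl }) ∷ []) ∷ [] ∷ []

  Proper : List Pt → Set
  Proper B = Unique B × length B ≡ 5

  crossed-proper : ∀ {σ} → Distinct σ → ∀ t {x y} → x ≢ 0# → y ≢ 0# → Proper (realise (crossed σ) t x y)
  crossed-proper d t {x} {y} x≢0 y≢0 = pair-unique d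
    (⊕-≢ t (·-≢ x≢0 ∘ ⊕-cancelʳ 0# _ _)) (⊕-≢ t (·-≢ y≢0 ∘ ⊕-cancelˡ 0# _ _)) , refl

  doubled-proper : ∀ {σ} → Distinct σ → ∀ t x {y} → y ≢ 0# → Proper (realise (doubled σ) t x y)
  doubled-proper d t x {y} y≢0 = pair-unique d
    (⊕-≢ t (·-≢ y≢0 ∘ ⊕-cancelˡ 0# _ _)) (⊕-≢ t (·-≢ y≢0 ∘ ⊕-cancelˡ 0# _ _)) , refl

  develop-proper : ∀ {b} → Valid b → ∀ x → All Proper (develop b x)
  develop-proper {b} (crossed! , doubled! , planes! , lines! , _) x =
    All.concat⁺ (All.map⁺ (All.universal (λ t → All.++⁺
      (pairs t x)
      (All.++⁺
        (All-concatMap planes! (λ tr → All.map⁺ (All.universal (transversal-realise tr t x) elements)))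
        (All.map⁺ (All.map (λ tr → transversal-realise tr t x 0#) lines!)))) elements))
    where
    pairs : ∀ t x → All Proper (concatMap (λ B → map (realise B t x) halfSystem) (pairTemplates b x))
    pairs t zero    = All-concatMap {P = λ B → ∀ y → y ≢ 0# → Proper (realise B t zero y)}
      (All.map⁺ (All.map (λ d y → doubled-proper d t zero) doubled!))
      (λ p → All.map⁺ (All.map (p _) halfSystem-≢0))
    pairs t (suc x) = All-concatMap {P = λ B → ∀ y → y ≢ 0# → Proper (realise B t (suc x) y)}
      (All.map⁺ (All.map (λ d y → crossed-proper d t (λ ())) crossed!))
      (λ p → All.map⁺ (All.map (p _) halfSystem-≢0))

  colouredBlocks-proper : ∀ {σ} → Good σ → All (λ (c , B) → Proper B) (colouredBlocks σ)
  colouredBlocks-proper {σ} (bundles! , extras! , _) = All.++⁺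
    (All-concatMap (All.universal bundles! (allFin w)) (λ valid →
      All-concatMap (All.universal (develop-proper valid) elements) (λ p → All.map⁺ p)))
    (All-concatMap (All.universal extras! (allFin u)) (λ valid → All.map⁺ (develop-proper valid 0#)))

  -- Sums over developed blocks

  orbit : (List Pt → ℕ) → Template → Z → Z → ℕ
  orbit φ B x y = ∑ elements (λ t → φ (realise B t x y))

  -- The sum over translations is moved innermost, because it is the one that can be evaluated for a
  -- single template with fixed parameters.
  ∑-develop : ∀ b x φ → ∑ (develop b x) φ ≡
    ∑ (pairTemplates b x) (λ B → ∑ halfSystem (orbit φ B x)) +
    (∑ (planes b) (λ B → ∑ elements (orbit φ B x)) + ∑ (lines b) (λ B → orbit φ B x 0#))
  ∑-develop b x φ = begin
    ∑ (develop b x) φ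
      ≡⟨ ∑-concatMap (λ t → pairs t ++ plane t ++ line t) elements φ ⟩
    ∑ elements (λ t → ∑ (pairs t ++ plane t ++ line t) φ)
      ≡⟨ ∑-cong elements (λ t → trans (∑-++ (pairs t) _ φ) (cong₂ _+_
           (expand t (pairTemplates b x) halfSystem)
           (trans (∑-++ (plane t) _ φ) (cong₂ _+_
             (expand t (planes b) elements)
             (∑-map (λ B → realise B t x 0#) (lines b) φ))))) ⟩
    ∑ elements (λ t → inPairs t + (inPlanes t + inLines t))
      ≡⟨ trans (∑-+ elements inPairs _) (cong (∑ elements inPairs +_) (∑-+ elements inPlanes inLines)) ⟩
    ∑ elements inPairs + (∑ elements inPlanes + ∑ elements inLines)
      ≡⟨ cong₂ _+_ (collect (pairTemplates b x) halfSystem)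
           (cong₂ _+_ (collect (planes b) elements) (∑-swap elements (lines b) (λ t B → φ (realise B t x 0#)))) ⟩
    _ ∎
    where
    pairs plane line : Z → List (List Pt)
    pairs t = concatMap (λ B → map (realise B t x) halfSystem) (pairTemplates b x)
    plane t = concatMap (λ B → map (realise B t x) elements) (planes b)
    line t = map (λ B → realise B t x 0#) (lines b)

    inPairs inPlanes inLines : Z → ℕ
    inPairs t = ∑ (pairTemplates b x) (λ B → ∑ halfSystem (λ y → φ (realise B t x y)))
    inPlanes t = ∑ (planes b) (λ B → ∑ elements (λ y → φ (realise B t x y)))
    inLines t = ∑ (lines b) (λ B → φ (realise B t x 0#))

    expand : ∀ t Bs ys → ∑ (concatMap (λ B → map (realise B t x) ys) Bs) φ ≡
                         ∑ Bs (λ B → ∑ ys (λ y → φ (realise B t x y)))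
    expand t Bs ys = trans (∑-concatMap _ Bs φ) (∑-cong Bs (λ B → ∑-map (realise B t x) ys φ))

    collect : ∀ Bs ys → ∑ elements (λ t → ∑ Bs (λ B → ∑ ys (λ y → φ (realise B t x y)))) ≡
                        ∑ Bs (λ B → ∑ ys (orbit φ B x))
    collect Bs ys = trans
      (∑-swap elements Bs (λ t B → ∑ ys (λ y → φ (realise B t x y))))
      (∑-cong Bs (λ B → ∑-swap elements ys (λ t y → φ (realise B t x y))))

  ∑-colouredBlocks : ∀ σ (φ : Pt → List Pt → ℕ) →
    ∑ (colouredBlocks σ) (λ (c , B) → φ c B) ≡
    ∑ (allFin w) (λ e → ∑ elements (λ x → ∑ (develop (bundle σ e) x) (φ (inj₂ (e , x))))) +
    ∑ (allFin u) (λ f → ∑ (develop (extra σ f) 0#) (φ (inj₁ f)))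
  ∑-colouredBlocks σ φ = trans (∑-++ (concatMap byBundle (allFin w)) _ φ′) (cong₂ _+_
    (trans (∑-concatMap byBundle (allFin w) φ′) (∑-cong (allFin w) (λ e →
      trans (∑-concatMap (byResidue e) elements φ′) (∑-cong elements (λ x →
        ∑-map (inj₂ (e , x) ,_) (develop (bundle σ e) x) φ′)))))
    (trans (∑-concatMap byExtra (allFin u) φ′) (∑-cong (allFin u) (λ f →
        ∑-map (inj₁ f ,_) (develop (extra σ f) 0#) φ′))))
    where
    byResidue : Fin w → Z → List (Pt × List Pt)
    byResidue e x = map (inj₂ (e , x) ,_) (develop (bundle σ e) x)

    byBundle : Fin w → List (Pt × List Pt)
    byBundle e = concatMap (byResidue e) elements

    byExtra : Fin u → List (Pt × List Pt)
    byExtra f = map (inj₁ f ,_) (develop (extra σ f) 0#)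

    φ′ : Pt × List Pt → ℕ
    φ′ (c , B) = φ c B

  -- Colour classes

  -- How many of the `s` translates of an entry hit a given point of its location: all of them for a
  -- fixed point, exactly one for a moving point.
  weight : Location → ℕ
  weight (inj₁ _) = s
  weight (inj₂ _) = 1

  ⟦≟place⟧ : ∀ i z t x y k c → ⟦ inj₂ (i , z) ≟ᴾ place t x y (inj₂ k , c) ⟧ ≡
             ⟦ i ≟ k ⟧ * ⟦ z ≟ t ⊕ (proj₁ c · x ⊕ proj₂ c · y) ⟧
  ⟦≟place⟧ i z t x y k (a , b) = trans
    (⟦⟧-cong (λ { refl → refl , refl }) (λ { (refl , refl) → refl })
      (inj₂ (i , z) ≟ᴾ inj₂ (k , t ⊕ (a · x ⊕ b · y))) ((i ≟ k) ×-dec (z ≟ t ⊕ (a · x ⊕ b · y))))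
    (⟦⟧-× (i ≟ k) (z ≟ t ⊕ (a · x ⊕ b · y)))

  ⟦inj₁≟⟧ : ∀ (f k : Fin u) → ⟦ inj₁ f ≟ᴾ inj₁ k ⟧ ≡ ⟦ inj₁ f ≟ˡ inj₁ k ⟧
  ⟦inj₁≟⟧ f k = ⟦⟧-cong (λ { refl → refl }) (λ { refl → refl }) (inj₁ f ≟ᴾ inj₁ k) (inj₁ f ≟ˡ inj₁ k)

  ⟦inj₂≟⟧ : ∀ (i k : Fin w) → ⟦ i ≟ k ⟧ ≡ ⟦ inj₂ i ≟ˡ inj₂ k ⟧
  ⟦inj₂≟⟧ i k = ⟦⟧-cong (cong inj₂) (λ { refl → refl }) (i ≟ k) (inj₂ i ≟ˡ inj₂ k)

  orbit-entry : ∀ p x y e → ∑ elements (λ t → ⟦ p ≟ᴾ place t x y e ⟧) ≡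
                            weight (location p) * ⟦ location p ≟ˡ proj₁ e ⟧
  orbit-entry (inj₁ f) x y (inj₁ k , _) = begin
    ∑ elements (λ t → ⟦ inj₁ f ≟ᴾ inj₁ k ⟧)      ≡⟨ ∑-const elements _ ⟩
    length elements * ⟦ inj₁ f ≟ᴾ inj₁ k ⟧       ≡⟨ cong₂ _*_ (length-tabulate {n = s} id) (⟦inj₁≟⟧ f k) ⟩
    s * ⟦ inj₁ f ≟ˡ inj₁ k ⟧                     ∎
  orbit-entry (inj₁ f) x y (inj₂ k , _) = trans (∑-zero elements) (sym (*-zeroʳ s))
  orbit-entry (inj₂ (i , z)) x y (inj₁ k , _) = ∑-zero elements
  orbit-entry (inj₂ (i , z)) x y (inj₂ k , c) = begin
    ∑ elements (λ t → ⟦ inj₂ (i , z) ≟ᴾ place t x y (inj₂ k , c) ⟧)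
      ≡⟨ ∑-cong elements (λ t → ⟦≟place⟧ i z t x y k c) ⟩
    ∑ elements (λ t → ⟦ i ≟ k ⟧ * ⟦ z ≟ t ⊕ (proj₁ c · x ⊕ proj₂ c · y) ⟧)
      ≡⟨ ∑-*ˡ elements ⟦ i ≟ k ⟧ _ ⟩
    ⟦ i ≟ k ⟧ * ∑ elements (λ t → ⟦ z ≟ t ⊕ (proj₁ c · x ⊕ proj₂ c · y) ⟧)
      ≡⟨ cong₂ _*_ (⟦inj₂≟⟧ i k) (∑-translate z _) ⟩
    ⟦ inj₂ i ≟ˡ inj₂ k ⟧ * 1
      ≡⟨ *-comm ⟦ inj₂ i ≟ˡ inj₂ k ⟧ 1 ⟩
    1 * ⟦ inj₂ i ≟ˡ inj₂ k ⟧ ∎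

  orbit-mult : ∀ p B x y → orbit (λ B → mult B p) B x y ≡
               weight (location p) * ∑ B (λ e → ⟦ location p ≟ˡ proj₁ e ⟧)
  orbit-mult p B x y = begin
    ∑ elements (λ t → mult (realise B t x y) p)
      ≡⟨ ∑-cong elements (λ t → ∑-map (place t x y) B (λ q → ⟦ p ≟ᴾ q ⟧)) ⟩
    ∑ elements (λ t → ∑ B (λ e → ⟦ p ≟ᴾ place t x y e ⟧))
      ≡⟨ ∑-swap elements B (λ t e → ⟦ p ≟ᴾ place t x y e ⟧) ⟩
    ∑ B (λ e → ∑ elements (λ t → ⟦ p ≟ᴾ place t x y e ⟧))
      ≡⟨ ∑-cong B (orbit-entry p x y) ⟩
    ∑ B (λ e → weight (location p) * ⟦ location p ≟ˡ proj₁ e ⟧)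
      ≡⟨ ∑-*ˡ B (weight (location p)) _ ⟩
    weight (location p) * ∑ B (λ e → ⟦ location p ≟ˡ proj₁ e ⟧) ∎

  ∑-develop-mult : ∀ b x p → ∑ (develop b x) (λ B → mult B p) ≡
    weight (location p) * (m * occurrences (location p) (pairTemplates b x) +
      (s * occurrences (location p) (planes b) + occurrences (location p) (lines b)))
  ∑-develop-mult b x p = trans (∑-develop b x (λ B → mult B p)) (trans
    (cong₂ _+_ (scaled (pairTemplates b x) halfSystem m (length-tabulate _))
      (cong₂ _+_ (scaled (planes b) elements s (length-tabulate {n = s} id))
        (trans (∑-cong (lines b) (λ B → orbit-mult p B x 0#)) (∑-*ˡ (lines b) W _))))
    (collect W m s (occurrences ℓ (pairTemplates b x)) (occurrences ℓ (planes b)) (occurrences ℓ (lines b))))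
    where
    ℓ = location p
    W = weight ℓ

    scaled : ∀ Bs (ys : List Z) k → length ys ≡ k →
             ∑ Bs (λ B → ∑ ys (orbit (λ B → mult B p) B x)) ≡ k * (W * occurrences ℓ Bs)
    scaled Bs ys k len = begin
      ∑ Bs (λ B → ∑ ys (orbit (λ B → mult B p) B x))
        ≡⟨ ∑-cong Bs (λ B → trans (∑-cong ys (orbit-mult p B x)) (trans (∑-const ys _) (cong (_* _) len))) ⟩
      ∑ Bs (λ B → k * (W * ∑ B (λ e → ⟦ ℓ ≟ˡ proj₁ e ⟧)))
        ≡⟨ trans (∑-*ˡ Bs k _) (cong (k *_) (∑-*ˡ Bs W _)) ⟩
      k * (W * occurrences ℓ Bs) ∎

    collect : ∀ W m s a b c → m * (W * a) + (s * (W * b) + W * c) ≡ W * (m * a + (s * b + c))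
    collect = solve 6 (λ W m s a b c → m :* (W :* a) :+ (s :* (W :* b) :+ W :* c) :=
                                       W :* (m :* a :+ (s :* b :+ c))) refl
      where open +-*-Solver

  -- Let C, F, L be the occurrences in pair shapes, planes and lines. As 2m = s - 1, in a copy 2 (mC
  -- + sF + L) + 1 = (C + 2F) s + (2L + 1 - C), and `Balanced` matches both coefficients with u +
  -- ws. A fixed point lies on lines only, and each is counted s times, which gives 2Ls + 1 = ws +
  -- u.
  colour-balance : ∀ {b ℓ} → Balanced b ℓ → ∀ x h → h + h + 1 ≡ u + w * s →
    weight ℓ * (m * occurrences ℓ (pairTemplates b x) +
      (s * occurrences ℓ (planes b) + occurrences ℓ (lines b))) ≡ h
  colour-balance {b} {ℓ} balanced x h odd =
    *-cancelˡ-≡ _ h 2 (+-cancelʳ-≡ 1 _ _ (trans (go ℓ balanced) (trans (sym odd) (twice-h h))))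
    where
    twice-h : ∀ h → h + h + 1 ≡ 2 * h + 1
    twice-h = solve 1 (λ h → h :+ h :+ con 1 := con 2 :* h :+ con 1) refl
      where open +-*-Solver

    κ : Location → ℕ
    κ ℓ = occurrences ℓ (pairTemplates b x)

    -- The shapes change at x = 0, but their occurrences do not, so all residues x have the same
    -- balance.
    κ≡ : ∀ ℓ k → occurrences ℓ (doubledTemplates b) ≡ k → occurrences ℓ (crossedTemplates b) ≡ k → κ ℓ ≡ k
    κ≡ ℓ k d c = pick x
      where
      pick : ∀ x → occurrences ℓ (pairTemplates b x) ≡ k
      pick zero    = d
      pick (suc _) = c

    go : ∀ ℓ → Balanced b ℓ →
         2 * (weight ℓ * (m * κ ℓ + (s * occurrences ℓ (planes b) + occurrences ℓ (lines b)))) + 1 ≡ u + w * s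
    go ℓ@(inj₁ f) (c≡0 , d≡0 , p≡0 , 2l≡w , u≡1) = begin
      2 * (s * (m * κ ℓ + (s * occurrences ℓ (planes b) + L))) + 1
        ≡⟨ cong₂ (λ k p → 2 * (s * (m * k + (s * p + L))) + 1) (κ≡ ℓ 0 d≡0 c≡0) p≡0 ⟩
      2 * (s * (m * 0 + (s * 0 + L))) + 1
        ≡⟨ expand m s L ⟩
      1 + 2 * L * s
        ≡⟨ cong₂ (λ a b → a + b * s) (sym u≡1) 2l≡w ⟩
      u + w * s ∎
      where
      L = occurrences ℓ (lines b)
      expand : ∀ m s L → 2 * (s * (m * 0 + (s * 0 + L))) + 1 ≡ 1 + 2 * L * s
      expand = solve 3 (λ m s L → con 2 :* (s :* (m :* con 0 :+ (s :* con 0 :+ L))) :+ con 1 :=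
                                  con 1 :+ con 2 :* L :* s) refl
        where open +-*-Solver
    go ℓ@(inj₂ i) (d≡c , c+2p≡w , 2l+1≡u+c) = begin
      2 * (1 * (m * κ ℓ + (s * F + L))) + 1
        ≡⟨ cong (λ k → 2 * (1 * (m * k + (s * F + L))) + 1) (κ≡ ℓ C d≡c refl) ⟩
      2 * (1 * (m * C + (s * F + L))) + 1
        ≡⟨ split m C F L ⟩
      (m + m) * C + 2 * F * s + (2 * L + 1)
        ≡⟨ cong ((m + m) * C + 2 * F * s +_) 2l+1≡u+c ⟩
      (m + m) * C + 2 * F * s + (u + C)
        ≡⟨ regroup m C F u ⟩
      u + (C + 2 * F) * s
        ≡⟨ cong (λ a → u + a * s) c+2p≡w ⟩
      u + w * s ∎
      where
      C = occurrences ℓ (crossedTemplates b)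
      F = occurrences ℓ (planes b)
      L = occurrences ℓ (lines b)
      split : ∀ m C F L → 2 * (1 * (m * C + (suc (m + m) * F + L))) + 1 ≡
                          (m + m) * C + 2 * F * suc (m + m) + (2 * L + 1)
      split = solve 4 (λ m C F L → con 2 :* (con 1 :* (m :* C :+ ((con 1 :+ (m :+ m)) :* F :+ L))) :+ con 1 :=
        (m :+ m) :* C :+ con 2 :* F :* (con 1 :+ (m :+ m)) :+ (con 2 :* L :+ con 1)) refl
        where open +-*-Solver
      regroup : ∀ m C F u → (m + m) * C + 2 * F * suc (m + m) + (u + C) ≡ u + (C + 2 * F) * suc (m + m)
      regroup = solve 4 (λ m C F u → (m :+ m) :* C :+ con 2 :* F :* (con 1 :+ (m :+ m)) :+ (u :+ C) :=
        u :+ (C :+ con 2 :* F) :* (con 1 :+ (m :+ m))) refl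
        where open +-*-Solver

  develop-regular : ∀ {b} → Valid b → ∀ x p h → h + h + 1 ≡ u + w * s →
                    ∑ (develop b x) (λ B → mult B p) ≡ h
  develop-regular {b} (_ , _ , _ , _ , fixed , moving) x p h odd =
    trans (∑-develop-mult b x p) (colour-balance {b} {location p} (balanced (location p)) x h odd)
    where
    balanced : ∀ ℓ → Balanced b ℓ
    balanced (inj₁ f) = fixed f
    balanced (inj₂ i) = moving i

  colourClass-regular : ∀ {σ} → Good σ → ∀ c p h → h + h + 1 ≡ u + w * s →
    ∑ (colouredBlocks σ) (λ (c′ , B) → ⟦ c ≟ᴾ c′ ⟧ * mult B p) ≡ h
  colourClass-regular {σ} (bundles! , extras! , _) c p h odd = begin
    ∑ (colouredBlocks σ) (λ (c′ , B) → ⟦ c ≟ᴾ c′ ⟧ * mult B p)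
      ≡⟨ ∑-colouredBlocks σ (λ c′ B → ⟦ c ≟ᴾ c′ ⟧ * mult B p) ⟩
    ∑ (allFin w) (λ e → ∑ elements (λ x → ∑ (develop (bundle σ e) x) (λ B → ⟦ c ≟ᴾ inj₂ (e , x) ⟧ * mult B p))) +
    ∑ (allFin u) (λ f → ∑ (develop (extra σ f) 0#) (λ B → ⟦ c ≟ᴾ inj₁ f ⟧ * mult B p))
      ≡⟨ cong₂ _+_
           (∑-cong (allFin w) (λ e → ∑-cong elements (λ x → trans
             (∑-*ˡ (develop (bundle σ e) x) ⟦ c ≟ᴾ inj₂ (e , x) ⟧ _)
             (cong (⟦ c ≟ᴾ inj₂ (e , x) ⟧ *_) (develop-regular (bundles! e) x p h odd)))))
           (∑-cong (allFin u) (λ f → trans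
             (∑-*ˡ (develop (extra σ f) 0#) ⟦ c ≟ᴾ inj₁ f ⟧ _)
             (cong (⟦ c ≟ᴾ inj₁ f ⟧ *_) (develop-regular (extras! f) 0# p h odd)))) ⟩
    ∑ (allFin w) (λ e → ∑ elements (λ x → ⟦ c ≟ᴾ inj₂ (e , x) ⟧ * h)) +
    ∑ (allFin u) (λ f → ⟦ c ≟ᴾ inj₁ f ⟧ * h)
      ≡⟨ pick c ⟩
    h ∎
    where
    pick : ∀ c → ∑ (allFin w) (λ e → ∑ elements (λ x → ⟦ c ≟ᴾ inj₂ (e , x) ⟧ * h)) +
                 ∑ (allFin u) (λ f → ⟦ c ≟ᴾ inj₁ f ⟧ * h) ≡ h
    pick (inj₁ f) = cong₂ _+_
      (trans (∑-cong (allFin w) (λ e → ∑-zero elements)) (∑-zero (allFin w)))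
      (∑-sift′ (λ k → inj₁ f ≟ᴾ inj₁ k) f (λ k → Sum.inj₁-injective) refl (λ _ → h))
    pick (inj₂ (i , z)) = trans (cong₂ _+_
      (begin
        ∑ (allFin w) (λ e → ∑ elements (λ x → ⟦ inj₂ (i , z) ≟ᴾ inj₂ (e , x) ⟧ * h))
          ≡⟨ ∑-cong (allFin w) (λ e → begin
               ∑ elements (λ x → ⟦ inj₂ (i , z) ≟ᴾ inj₂ (e , x) ⟧ * h)
                 ≡⟨ ∑-cong elements (λ x → trans (cong (_* h) (pair≟ e x)) (*-assoc ⟦ i ≟ e ⟧ _ h)) ⟩
               ∑ elements (λ x → ⟦ i ≟ e ⟧ * (⟦ z ≟ x ⟧ * h))
                 ≡⟨ ∑-*ˡ elements ⟦ i ≟ e ⟧ _ ⟩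
               ⟦ i ≟ e ⟧ * ∑ elements (λ x → ⟦ z ≟ x ⟧ * h)
                 ≡⟨ cong (⟦ i ≟ e ⟧ *_) (∑-sift z (λ _ → h)) ⟩
               ⟦ i ≟ e ⟧ * h ∎) ⟩
        ∑ (allFin w) (λ e → ⟦ i ≟ e ⟧ * h)
          ≡⟨ ∑-sift i (λ _ → h) ⟩
        h ∎)
      (∑-zero (allFin u)))
      (+-identityʳ h)
      where
      pair≟ : ∀ e x → ⟦ inj₂ (i , z) ≟ᴾ inj₂ (e , x) ⟧ ≡ ⟦ i ≟ e ⟧ * ⟦ z ≟ x ⟧
      pair≟ e x = trans
        (⟦⟧-cong (λ { refl → refl , refl }) (λ { (refl , refl) → refl })
          (inj₂ (i , z) ≟ᴾ inj₂ (e , x)) ((i ≟ e) ×-dec (z ≟ x)))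
        (⟦⟧-× (i ≟ e) (z ≟ x))

-- Counting the coloured blocks through two points

module PairCounts (u w m : ℕ) where

  open Templates u w
  open Residues m
  open Realisation u w m
  open Multiplicity _≟ᴾ_

  ranged : Range → (Z → Z → ℕ) → ℕ
  ranged xy-range g = ∑ elements (λ x → ∑ elements (g x))
  ranged x-range  g = ∑ elements (λ x → g x 0#)
  ranged y-range  g = ∑ elements (g 0#)
  ranged no-range g = g 0# 0#

  ranged-cong : ∀ ρ {g h} → (∀ x y → g x y ≡ h x y) → ranged ρ g ≡ ranged ρ h
  ranged-cong xy-range eq = ∑-cong elements (λ x → ∑-cong elements (eq x))
  ranged-cong x-range  eq = ∑-cong elements (λ x → eq x 0#)
  ranged-cong y-range  eq = ∑-cong elements (eq 0#)
  ranged-cong no-range eq = eq 0# 0#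

  ranged-∑ : ∀ {A : Set} ρ (xs : List A) (g : A → Z → Z → ℕ) →
             ranged ρ (λ x y → ∑ xs (λ a → g a x y)) ≡ ∑ xs (λ a → ranged ρ (g a))
  ranged-∑ xy-range xs g = trans
    (∑-cong elements (λ x → ∑-swap elements xs (λ y a → g a x y)))
    (∑-swap elements xs (λ x a → ∑ elements (g a x)))
  ranged-∑ x-range  xs g = ∑-swap elements xs (λ x a → g a x 0#)
  ranged-∑ y-range  xs g = ∑-swap elements xs (λ y a → g a 0# y)
  ranged-∑ no-range xs g = refl

  ranged-*ˡ : ∀ ρ c g → ranged ρ (λ x y → c * g x y) ≡ c * ranged ρ g
  ranged-*ˡ xy-range c g = trans
    (∑-cong elements (λ x → ∑-*ˡ elements c (g x)))
    (∑-*ˡ elements c (λ x → ∑ elements (g x)))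
  ranged-*ˡ x-range  c g = ∑-*ˡ elements c _
  ranged-*ˡ y-range  c g = ∑-*ˡ elements c _
  ranged-*ˡ no-range c g = refl

  ∑-elements-const : ∀ c → ∑ elements (λ _ → c) ≡ s * c
  ∑-elements-const c = trans (∑-const elements c) (cong (_* c) (length-tabulate {n = s} id))

  ranged-1 : ∀ ρ δ → ranged ρ (λ _ _ → 1) ≡ ⟪ uniform (dimension ρ) ⟫ s δ
  ranged-1 ρ δ = trans (go ρ) (sym (⟪uniform⟫ (dimension ρ) s δ))
    where
    ones : ∑ elements (λ _ → 1) ≡ s
    ones = trans (∑-elements-const 1) (*-identityʳ s)

    go : ∀ ρ → ranged ρ (λ _ _ → 1) ≡ lookup (1 ∷ s ∷ s * s ∷ []) (dimension ρ)
    go xy-range = trans (∑-cong elements (λ _ → ones)) (∑-elements-const s)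
    go x-range  = ones
    go y-range  = ones
    go no-range = refl

  value : Coeff × Coeff → Z → Z → Z
  value (a , b) x y = a · x ⊕ b · y

  ⊕-split₁ : ∀ z a b x y → z ⊕ value (a , b) x y ≡ z ⊕ b · y ⊕ a · x
  ⊕-split₁ z a b x y = trans (cong (z ⊕_) (⊕-comm (a · x) (b · y))) (sym (⊕-assoc z (b · y) (a · x)))

  ⊕-split₂ : ∀ z a b x y → z ⊕ value (a , b) x y ≡ z ⊕ a · x ⊕ b · y
  ⊕-split₂ z a b x y = sym (⊕-assoc z (a · x) (b · y))

  ⟦⟧-≡ : ∀ {x x′ y y′ : Z} → x ≡ x′ → y ≡ y′ → ⟦ x ≟ y ⟧ ≡ ⟦ x′ ≟ y′ ⟧
  ⟦⟧-≡ refl refl = refl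

  meeting : Z → Z → Coeff × Coeff → Coeff × Coeff → Z → Z → ℕ
  meeting z z′ c c′ x y = ⟦ z′ ⊕ value c x y ≟ z ⊕ value c′ x y ⟧

  ∑x-meeting : ∀ {a a′} → a ≢ a′ → ∀ z z′ b b′ y →
               ∑ elements (λ x → meeting z z′ (a , b) (a′ , b′) x y) ≡ 1
  ∑x-meeting {a} {a′} a≢a′ z z′ b b′ y = trans
    (∑-cong elements (λ x → ⟦⟧-≡ (⊕-split₁ z′ a b x y) (⊕-split₁ z a′ b′ x y)))
    (∑-linear a≢a′ (z′ ⊕ b · y) (z ⊕ b′ · y))

  ∑y-meeting : ∀ {b b′} → b ≢ b′ → ∀ z z′ a a′ x →
               ∑ elements (meeting z z′ (a , b) (a′ , b′) x) ≡ 1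
  ∑y-meeting {b} {b′} b≢b′ z z′ a a′ x = trans
    (∑-cong elements (λ y → ⟦⟧-≡ (⊕-split₂ z′ a b x y) (⊕-split₂ z a′ b′ x y)))
    (∑-linear b≢b′ (z′ ⊕ a · x) (z ⊕ a′ · x))

  meeting-same : ∀ z z′ {f f′} → f ≡ f′ → ⟦ z′ ⊕ f ≟ z ⊕ f′ ⟧ ≡ ⟦ z′ ≟ z ⟧
  meeting-same z z′ {f} refl = ⟦⟧-cong (⊕-cancelʳ f z′ z) (cong (_⊕ f)) (z′ ⊕ f ≟ z ⊕ f) (z′ ≟ z)

  ⊕-·-zero : ∀ f b b′ → f ⊕ b · 0# ≡ f ⊕ b′ · 0#
  ⊕-·-zero f b b′ = cong (f ⊕_) (trans (·-zero b) (sym (·-zero b′)))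

  ·-zero-⊕ : ∀ f a a′ → a · 0# ⊕ f ≡ a′ · 0# ⊕ f
  ·-zero-⊕ f a a′ = cong (_⊕ f) (trans (·-zero a) (sym (·-zero a′)))

  -- A parameter held at 0 erases its coefficients, so only the running ones are compared. Where
  -- these differ, the equation has a unique solution in that parameter; where all agree, both sides
  -- carry the same summand, which cancels.
  ranged-meeting : ∀ ρ z z′ c c′ → ranged ρ (meeting z z′ c c′) ≡ ⟪ meetings ρ c c′ ⟫ s ⟦ z′ ≟ z ⟧
  ranged-meeting xy-range z z′ (a , b) (a′ , b′) with a ≟ᶜ a′ | b ≟ᶜ b′
  ... | yes refl | yes refl = begin
    ∑ elements (λ x → ∑ elements (meeting z z′ (a , b) (a , b) x))
      ≡⟨ ∑-cong elements (λ x → trans (∑-cong elements (λ y → meeting-same z z′ refl)) (∑-elements-const _)) ⟩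
    ∑ elements (λ x → s * ⟦ z′ ≟ z ⟧)
      ≡⟨ ∑-elements-const _ ⟩
    s * (s * ⟦ z′ ≟ z ⟧)
      ≡⟨ sym (*-assoc s s _) ⟩
    s * s * ⟦ z′ ≟ z ⟧
      ≡⟨ sym (⟪diagonal⟫ (suc (suc zero)) s _) ⟩
    ⟪ diagonal (suc (suc zero)) ⟫ s ⟦ z′ ≟ z ⟧ ∎
  ... | yes refl | no b≢b′ = trans
    (∑-cong elements (∑y-meeting b≢b′ z z′ a a)) (ranged-1 x-range ⟦ z′ ≟ z ⟧)
  -- For each fixed y the equation is solved for x, so x has to become the inner variable.
  ... | no a≢a′ | _ = trans
    (∑-swap elements elements (meeting z z′ (a , b) (a′ , b′)))
    (trans (∑-cong elements (∑x-meeting a≢a′ z z′ b b′)) (ranged-1 x-range ⟦ z′ ≟ z ⟧))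
  ranged-meeting x-range z z′ (a , b) (a′ , b′) with a ≟ᶜ a′
  ... | yes refl = begin
    ∑ elements (λ x → meeting z z′ (a , b) (a , b′) x 0#)
      ≡⟨ ∑-cong elements (λ x → meeting-same z z′ (⊕-·-zero (a · x) b b′)) ⟩
    ∑ elements (λ x → ⟦ z′ ≟ z ⟧)
      ≡⟨ ∑-elements-const _ ⟩
    s * ⟦ z′ ≟ z ⟧
      ≡⟨ sym (⟪diagonal⟫ (suc zero) s _) ⟩
    ⟪ diagonal (suc zero) ⟫ s ⟦ z′ ≟ z ⟧ ∎
  ... | no a≢a′ = trans (∑x-meeting a≢a′ z z′ b b′ 0#) (ranged-1 no-range ⟦ z′ ≟ z ⟧)
  ranged-meeting y-range z z′ (a , b) (a′ , b′) with b ≟ᶜ b′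
  ... | yes refl = begin
    ∑ elements (meeting z z′ (a , b) (a′ , b) 0#)
      ≡⟨ ∑-cong elements (λ y → meeting-same z z′ (·-zero-⊕ (b · y) a a′)) ⟩
    ∑ elements (λ x → ⟦ z′ ≟ z ⟧)
      ≡⟨ ∑-elements-const _ ⟩
    s * ⟦ z′ ≟ z ⟧
      ≡⟨ sym (⟪diagonal⟫ (suc zero) s _) ⟩
    ⟪ diagonal (suc zero) ⟫ s ⟦ z′ ≟ z ⟧ ∎
  ... | no b≢b′ = trans (∑y-meeting b≢b′ z z′ a a′ 0#) (ranged-1 no-range ⟦ z′ ≟ z ⟧)
  ranged-meeting no-range z z′ (a , b) (a′ , b′) = trans
    (meeting-same z z′ (trans (⊕-·-zero (a · 0#) b b′) (·-zero-⊕ (b′ · 0#) a a′)))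
    (trans (sym (*-identityˡ _)) (sym (⟪diagonal⟫ zero s ⟦ z′ ≟ z ⟧)))

  joint : Pt → Pt → List Pt → ℕ
  joint p q B = mult B p * mult B q

  jointEntry : Pt → Pt → Entry → Entry → Z → Z → ℕ
  jointEntry p q e e′ x y = ∑ elements (λ t → ⟦ p ≟ᴾ place t x y e ⟧ * ⟦ q ≟ᴾ place t x y e′ ⟧)

  orbit-joint : ∀ p q B x y → orbit (joint p q) B x y ≡ ∑ B (λ e → ∑ B (λ e′ → jointEntry p q e e′ x y))
  orbit-joint p q B x y = begin
    ∑ elements (λ t → mult (realise B t x y) p * mult (realise B t x y) q)
      ≡⟨ ∑-cong elements (λ t → trans
           (cong₂ _*_ (∑-map (place t x y) B (λ r → ⟦ p ≟ᴾ r ⟧)) (∑-map (place t x y) B (λ r → ⟦ q ≟ᴾ r ⟧)))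
           (∑-product B B (λ e → ⟦ p ≟ᴾ place t x y e ⟧) (λ e′ → ⟦ q ≟ᴾ place t x y e′ ⟧))) ⟩
    ∑ elements (λ t → ∑ B (λ e → ∑ B (λ e′ → ⟦ p ≟ᴾ place t x y e ⟧ * ⟦ q ≟ᴾ place t x y e′ ⟧)))
      ≡⟨ ∑-swap elements B (λ t e → ∑ B (λ e′ → ⟦ p ≟ᴾ place t x y e ⟧ * ⟦ q ≟ᴾ place t x y e′ ⟧)) ⟩
    ∑ B (λ e → ∑ elements (λ t → ∑ B (λ e′ → ⟦ p ≟ᴾ place t x y e ⟧ * ⟦ q ≟ᴾ place t x y e′ ⟧)))
      ≡⟨ ∑-cong B (λ e → ∑-swap elements B (λ t e′ → ⟦ p ≟ᴾ place t x y e ⟧ * ⟦ q ≟ᴾ place t x y e′ ⟧)) ⟩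
    ∑ B (λ e → ∑ B (λ e′ → jointEntry p q e e′ x y)) ∎

  -- The symbolic weight is correct for one pair of entries. Fixed and moving points differ only
  -- here; everything after it is linear. For two moving points δ is the indicator of equal
  -- residues.
  CountedBy : Pt → Pt → ℕ → Set
  CountedBy p q δ = ∀ ρ e e′ → ranged ρ (jointEntry p q e e′) ≡
    ⟦ location p ≟ˡ proj₁ e ⟧ * (⟦ location q ≟ˡ proj₁ e′ ⟧ * ⟪ weights ρ (location p) (proj₂ e) (proj₂ e′) ⟫ s δ)

  moving-counted : ∀ i z j z′ → CountedBy (inj₂ (i , z)) (inj₂ (j , z′)) ⟦ z′ ≟ z ⟧
  moving-counted i z j z′ ρ (inj₁ k , c) e′ = ranged-cong-0 ρ
    where
    ranged-cong-0 : ∀ ρ → ranged ρ (jointEntry (inj₂ (i , z)) (inj₂ (j , z′)) (inj₁ k , c) e′) ≡ 0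
    ranged-cong-0 ρ = trans (ranged-cong ρ (λ x y → ∑-zero elements)) (ranged-*ˡ ρ 0 (λ _ _ → 0))
  moving-counted i z j z′ ρ (inj₂ k , c) (inj₁ k′ , c′) = trans
    (ranged-cong ρ (λ x y → trans
      (∑-cong elements (λ t → *-zeroʳ ⟦ inj₂ (i , z) ≟ᴾ place t x y (inj₂ k , c) ⟧)) (∑-zero elements)))
    (trans (ranged-*ˡ ρ 0 (λ _ _ → 0)) (sym (*-zeroʳ ⟦ inj₂ i ≟ˡ inj₂ k ⟧)))
  moving-counted i z j z′ ρ (inj₂ k , c) (inj₂ k′ , c′) = begin
    ranged ρ (jointEntry (inj₂ (i , z)) (inj₂ (j , z′)) (inj₂ k , c) (inj₂ k′ , c′))
      ≡⟨ ranged-cong ρ (λ x y → trans (∑-cong elements (λ t → separate x y t))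
           (trans (∑-*ˡ elements (⟦ i ≟ k ⟧ * ⟦ j ≟ k′ ⟧) _)
                  (cong (⟦ i ≟ k ⟧ * ⟦ j ≟ k′ ⟧ *_) (∑-translates z z′ (value c x y) (value c′ x y))))) ⟩
    ranged ρ (λ x y → ⟦ i ≟ k ⟧ * ⟦ j ≟ k′ ⟧ * meeting z z′ c c′ x y)
      ≡⟨ ranged-*ˡ ρ (⟦ i ≟ k ⟧ * ⟦ j ≟ k′ ⟧) (meeting z z′ c c′) ⟩
    ⟦ i ≟ k ⟧ * ⟦ j ≟ k′ ⟧ * ranged ρ (meeting z z′ c c′)
      ≡⟨ cong₂ _*_ (cong₂ _*_ (⟦inj₂≟⟧ i k) (⟦inj₂≟⟧ j k′)) (ranged-meeting ρ z z′ c c′) ⟩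
    ⟦ inj₂ i ≟ˡ inj₂ k ⟧ * ⟦ inj₂ j ≟ˡ inj₂ k′ ⟧ * ⟪ meetings ρ c c′ ⟫ s ⟦ z′ ≟ z ⟧
      ≡⟨ *-assoc ⟦ inj₂ i ≟ˡ inj₂ k ⟧ _ _ ⟩
    ⟦ inj₂ i ≟ˡ inj₂ k ⟧ * (⟦ inj₂ j ≟ˡ inj₂ k′ ⟧ * ⟪ meetings ρ c c′ ⟫ s ⟦ z′ ≟ z ⟧) ∎
    where
    rearrange : ∀ a b c d → (a * b) * (c * d) ≡ a * c * (b * d)
    rearrange = solve 4 (λ a b c d → (a :* b) :* (c :* d) := a :* c :* (b :* d)) refl
      where open +-*-Solver
    separate : ∀ x y t → ⟦ inj₂ (i , z) ≟ᴾ place t x y (inj₂ k , c) ⟧ * ⟦ inj₂ (j , z′) ≟ᴾ place t x y (inj₂ k′ , c′) ⟧ ≡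
                         ⟦ i ≟ k ⟧ * ⟦ j ≟ k′ ⟧ * (⟦ z ≟ t ⊕ value c x y ⟧ * ⟦ z′ ≟ t ⊕ value c′ x y ⟧)
    separate x y t = trans
      (cong₂ _*_ (⟦≟place⟧ i z t x y k c) (⟦≟place⟧ j z′ t x y k′ c′))
      (rearrange ⟦ i ≟ k ⟧ _ ⟦ j ≟ k′ ⟧ _)

  -- Holds for every δ, because the weights at a fixed point have V = 0.
  fixed-counted : ∀ f j z′ δ → CountedBy (inj₁ f) (inj₂ (j , z′)) δ
  fixed-counted f j z′ δ ρ e@(inj₂ k , c) e′ =
    trans (ranged-cong ρ (λ x y → ∑-zero elements)) (ranged-*ˡ ρ 0 (λ _ _ → 0))
  fixed-counted f j z′ δ ρ e@(inj₁ k , c) e′ = begin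
    ranged ρ (jointEntry (inj₁ f) (inj₂ (j , z′)) e e′)
      ≡⟨ ranged-cong ρ (λ x y → trans
           (∑-*ˡ elements ⟦ inj₁ f ≟ᴾ inj₁ k ⟧ _)
           (trans (cong₂ _*_ (⟦inj₁≟⟧ f k) (trans (orbit-entry (inj₂ (j , z′)) x y e′) (*-identityˡ _)))
                  (sym (*-identityʳ _)))) ⟩
    ranged ρ (λ x y → ⟦ inj₁ f ≟ˡ inj₁ k ⟧ * ⟦ inj₂ j ≟ˡ proj₁ e′ ⟧ * 1)
      ≡⟨ trans (ranged-*ˡ ρ (⟦ inj₁ f ≟ˡ inj₁ k ⟧ * ⟦ inj₂ j ≟ˡ proj₁ e′ ⟧) (λ _ _ → 1))
               (cong (⟦ inj₁ f ≟ˡ inj₁ k ⟧ * ⟦ inj₂ j ≟ˡ proj₁ e′ ⟧ *_) (ranged-1 ρ δ)) ⟩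
    ⟦ inj₁ f ≟ˡ inj₁ k ⟧ * ⟦ inj₂ j ≟ˡ proj₁ e′ ⟧ * ⟪ uniform (dimension ρ) ⟫ s δ
      ≡⟨ *-assoc ⟦ inj₁ f ≟ˡ inj₁ k ⟧ _ _ ⟩
    ⟦ inj₁ f ≟ˡ inj₁ k ⟧ * (⟦ inj₂ j ≟ˡ proj₁ e′ ⟧ * ⟪ uniform (dimension ρ) ⟫ s δ) ∎

  ranged-count : ∀ p q δ → CountedBy p q δ → ∀ ρ Bs →
    ∑ Bs (λ B → ranged ρ (orbit (joint p q) B)) ≡ ⟪ count ρ Bs (location p) (location q) ⟫ s δ
  ranged-count p q δ counted ρ Bs = sym (trans (⟪∑ⁿ⟫ Bs _ s δ) (∑-cong Bs perTemplate))
    where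
    ℓ = location p
    ℓ′ = location q
    ∑-coefficients : ∀ ℓ B (f : Coeff × Coeff → ℕ) →
      ∑ (coefficients ℓ B) f ≡ ∑ B (λ e → ⟦ ℓ ≟ˡ proj₁ e ⟧ * f (proj₂ e))
    ∑-coefficients ℓ B f = trans
      (∑-map proj₂ (filter (λ e → ℓ ≟ˡ proj₁ e) B) f)
      (∑-filter (λ e → ℓ ≟ˡ proj₁ e) B (f ∘ proj₂))

    perTemplate : ∀ B → ⟪ ∑ⁿ (coefficients ℓ B) (λ c → ∑ⁿ (coefficients ℓ′ B) (weights ρ ℓ c)) ⟫ s δ ≡
                        ranged ρ (orbit (joint p q) B)
    perTemplate B = begin
      ⟪ ∑ⁿ (coefficients ℓ B) (λ c → ∑ⁿ (coefficients ℓ′ B) (weights ρ ℓ c)) ⟫ s δ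
        ≡⟨ ⟪∑ⁿ⟫ (coefficients ℓ B) (λ c → ∑ⁿ (coefficients ℓ′ B) (weights ρ ℓ c)) s δ ⟩
      ∑ (coefficients ℓ B) (λ c → ⟪ ∑ⁿ (coefficients ℓ′ B) (weights ρ ℓ c) ⟫ s δ)
        ≡⟨ ∑-coefficients ℓ B _ ⟩
      ∑ B (λ e → ⟦ ℓ ≟ˡ proj₁ e ⟧ * ⟪ ∑ⁿ (coefficients ℓ′ B) (weights ρ ℓ (proj₂ e)) ⟫ s δ)
        ≡⟨ ∑-cong B (λ e → trans
             (cong (⟦ ℓ ≟ˡ proj₁ e ⟧ *_) (trans (⟪∑ⁿ⟫ (coefficients ℓ′ B) (weights ρ ℓ (proj₂ e)) s δ) (∑-coefficients ℓ′ B _)))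
             (sym (∑-*ˡ B ⟦ ℓ ≟ˡ proj₁ e ⟧ _))) ⟩
      ∑ B (λ e → ∑ B (λ e′ → ⟦ ℓ ≟ˡ proj₁ e ⟧ * (⟦ ℓ′ ≟ˡ proj₁ e′ ⟧ * ⟪ weights ρ ℓ (proj₂ e) (proj₂ e′) ⟫ s δ)))
        ≡⟨ ∑-cong B (λ e → ∑-cong B (λ e′ → sym (counted ρ e e′))) ⟩
      ∑ B (λ e → ∑ B (λ e′ → ranged ρ (jointEntry p q e e′)))
        ≡⟨ sym (trans (ranged-∑ ρ B (λ e x y → ∑ B (λ e′ → jointEntry p q e e′ x y)))
                      (∑-cong B (λ e → ranged-∑ ρ B (jointEntry p q e)))) ⟩
      ranged ρ (λ x y → ∑ B (λ e → ∑ B (λ e′ → jointEntry p q e e′ x y)))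
        ≡⟨ sym (ranged-cong ρ (orbit-joint p q B)) ⟩
      ranged ρ (orbit (joint p q) B) ∎

  swap-last-pair : ∀ a b c d e → a + (b + (c + (d + e))) ≡ a + (b + (d + (c + e)))
  swap-last-pair = solve 5 (λ a b c d e → a :+ (b :+ (c :+ (d :+ e))) := a :+ (b :+ (d :+ (c :+ e)))) refl
    where open +-*-Solver

  swap-pairs : ∀ a b c d e → a + (b + (c + (d + e))) ≡ b + (a + (d + (c + e)))
  swap-pairs = solve 5 (λ a b c d e → a :+ (b :+ (c :+ (d :+ e))) := b :+ (a :+ (d :+ (c :+ e)))) refl
    where open +-*-Solver

  -- As y ↦ -y fixes these blocks, a half system of values of y produces each of them once.
  Even : Template → Set
  Even B = ∀ t x y p → mult (realise B t x (⊖ y)) p ≡ mult (realise B t x y) p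

  -- Negating y exchanges the third and fourth points and leaves the others in place.
  crossed-even : ∀ σ → Even (crossed σ)
  crossed-even (i , j , l) t x y p = trans
    (cong (λ y′ → at i x 0# + (at i (⊖ x) 0# + (at j 0# (⊖ y) + (at j 0# y′ + (at l 0# 0# + 0))))) (⊖-involutive y))
    (swap-last-pair (at i x 0#) (at i (⊖ x) 0#) (at j 0# (⊖ y)) (at j 0# y) (at l 0# 0# + 0))
    where
    at : Fin w → Z → Z → ℕ
    at k f g = ⟦ p ≟ᴾ inj₂ (k , t ⊕ (f ⊕ g)) ⟧

  -- Negating y exchanges the points within both pairs at once.
  doubled-even : ∀ σ → Even (doubled σ)
  doubled-even (i , j , l) t x y p = trans
    (cong (λ y′ → at i (⊖ y) + (at i y′ + (at j (⊖ y) + (at j y′ + (at l 0# + 0))))) (⊖-involutive y))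
    (swap-pairs (at i (⊖ y)) (at i y) (at j (⊖ y)) (at j y) (at l 0# + 0))
    where
    at : Fin w → Z → ℕ
    at k g = ⟦ p ≟ᴾ inj₂ (k , t ⊕ (0# ⊕ g)) ⟧

  even-half : ∀ {Bs} → All Even Bs → ∀ p q x →
    ∑ Bs (λ B → ∑ elements (orbit (joint p q) B x)) ≡
    ∑ Bs (λ B → orbit (joint p q) B x 0#) +
      (∑ Bs (λ B → ∑ halfSystem (orbit (joint p q) B x)) + ∑ Bs (λ B → ∑ halfSystem (orbit (joint p q) B x)))
  even-half {Bs} even p q x = trans
    (∑-cong-All even (λ B ev → ∑-even (orbit (joint p q) B x)
      (λ y → ∑-cong elements (λ t → cong₂ _*_ (ev t x y p) (ev t x y q)))))
    (trans (∑-+ Bs (λ B → orbit (joint p q) B x 0#) (λ B → ∑ halfSystem (orbit (joint p q) B x) + ∑ halfSystem (orbit (joint p q) B x)))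
           (cong (∑ Bs (λ B → orbit (joint p q) B x 0#) +_)
                 (∑-+ Bs (λ B → ∑ halfSystem (orbit (joint p q) B x)) (λ B → ∑ halfSystem (orbit (joint p q) B x)))))

  all-even : ∀ {f : Shape → Template} → (∀ σ → Even (f σ)) → ∀ σs → All Even (map f σs)
  all-even even σs = All.map⁺ (All.universal even σs)

  module _ (p q : Pt) (δ : ℕ) (counted : CountedBy p q δ) where

    ℓ ℓ′ : Location
    ℓ  = location p
    ℓ′ = location q

    ω : Template → Z → Z → ℕ
    ω = orbit (joint p q)

    ⟪_⟫ᴿ : Count → ℕ
    ⟪ c ⟫ᴿ = ⟪ c ⟫ s δ

    counts : ∀ ρ Bs → ⟪ count ρ Bs ℓ ℓ′ ⟫ᴿ ≡ ∑ Bs (λ B → ranged ρ (ω B))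
    counts ρ Bs = sym (ranged-count p q δ counted ρ Bs)

    -- A fixed colour has x = 0 only, so the doubled shapes alone are halved and the correction
    -- consists of their terms at y = 0.
    extra-pairs : ∀ b → 2 * ∑ (develop b 0#) (joint p q) + ⟪ extraExcess b ℓ ℓ′ ⟫ᴿ ≡ ⟪ extraFull b ℓ ℓ′ ⟫ᴿ
    extra-pairs b = begin
      2 * ∑ (develop b 0#) (joint p q) + ⟪ extraExcess b ℓ ℓ′ ⟫ᴿ
        ≡⟨ cong₂ (λ a c → 2 * a + c) (∑-develop b 0# (joint p q)) (counts no-range (doubledTemplates b)) ⟩
      2 * (H + (F + L)) + O
        ≡⟨ rearrange H F L O ⟩
      (O + (H + H)) + ((F + L) + (F + L))
        ≡⟨ cong (_+ ((F + L) + (F + L))) (sym (even-half (all-even doubled-even (doubledShapes b)) p q 0#)) ⟩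
      ∑ (doubledTemplates b) (λ B → ∑ elements (ω B 0#)) + ((F + L) + (F + L))
        ≡⟨ sym (trans (⟪⊞⟫ (count y-range (doubledTemplates b) ℓ ℓ′) (twice FL) s δ)
             (cong₂ _+_ (counts y-range (doubledTemplates b)) (trans (⟪⊞⟫ FL FL s δ) (cong₂ _+_ ⟪FL⟫ ⟪FL⟫)))) ⟩
      ⟪ extraFull b ℓ ℓ′ ⟫ᴿ ∎
      where
      H = ∑ (doubledTemplates b) (λ B → ∑ halfSystem (ω B 0#))
      F = ∑ (planes b) (λ B → ∑ elements (ω B 0#))
      L = ∑ (lines b) (λ B → ω B 0# 0#)
      O = ∑ (doubledTemplates b) (λ B → ω B 0# 0#)
      FL = count y-range (planes b) ℓ ℓ′ ⊞ count no-range (lines b) ℓ ℓ′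

      ⟪FL⟫ : ⟪ FL ⟫ᴿ ≡ F + L
      ⟪FL⟫ = trans (⟪⊞⟫ (count y-range (planes b) ℓ ℓ′) (count no-range (lines b) ℓ ℓ′) s δ)
                  (cong₂ _+_ (counts y-range (planes b)) (counts no-range (lines b)))

      rearrange : ∀ H F L O → 2 * (H + (F + L)) + O ≡ (O + (H + H)) + ((F + L) + (F + L))
      rearrange = solve 4 (λ H F L O → con 2 :* (H :+ (F :+ L)) :+ O :=
                                       (O :+ (H :+ H)) :+ ((F :+ L) :+ (F :+ L))) refl
        where open +-*-Solver

    -- Inclusion and exclusion: twice the crossed half sum over nonzero x is the sum over all (x,
    -- y), minus the terms with y = 0, minus those with x = 0, plus the term at (0, 0). Twice the
    -- doubled half sum is its sum over all y minus the term at y = 0. Subtracted terms form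
    -- `excess`, the others `full`.
    bundle-pairs : ∀ b → 2 * ∑ elements (λ x → ∑ (develop b x) (joint p q)) + ⟪ excess b ℓ ℓ′ ⟫ᴿ ≡ ⟪ full b ℓ ℓ′ ⟫ᴿ
    bundle-pairs b = begin
      2 * ∑ elements (λ x → ∑ (develop b x) (joint p q)) + ⟪ excess b ℓ ℓ′ ⟫ᴿ
        ≡⟨ cong₂ (λ a c → 2 * a + c)
             (trans (∑-cong elements (λ x → ∑-develop b x (joint p q)))
               (trans (∑-+ elements Kd (λ x → Fx x + Lx x)) (cong₂ _+_ (∑-allFin-suc Kd)
                 (trans (∑-+ elements Fx Lx) (cong₂ _+_ (∑-swap elements (planes b) (λ x B → ∑ elements (ω B x)))
                                                      (∑-swap elements (lines b) (λ x B → ω B x 0#)))))))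
             (trans (⟪⊞⟫ (Yc ⊞ Xc) Od s δ) (cong₂ _+_
               (trans (⟪⊞⟫ Yc Xc s δ) (cong₂ _+_ (counts y-range cs) (counts x-range cs)))
               (counts no-range ds))) ⟩
      2 * ((D₀ + R) + (F + L)) + ((Y + X) + O)
        ≡⟨ cong (λ v → 2 * ((D₀ + R) + (F + L)) + ((v + X) + O)) (even-half (all-even crossed-even (crossedShapes b)) p q 0#) ⟩
      2 * ((D₀ + R) + (F + L)) + (((O′ + (K₀ + K₀)) + X) + O)
        ≡⟨ rearrange D₀ R F L O′ K₀ X O ⟩
      (((O + (D₀ + D₀)) + (X + ((K₀ + R) + (K₀ + R)))) + O′) + ((F + L) + (F + L))
        ≡⟨ cong₂ (λ a c → ((a + c) + O′) + ((F + L) + (F + L)))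
             (sym (even-half (all-even doubled-even (doubledShapes b)) p q 0#)) (sym XY≡) ⟩
      ((Yd + XY) + O′) + ((F + L) + (F + L))
        ≡⟨ sym (trans (⟪⊞⟫ (yd ⊞ xyc ⊞ oc) (twice FL) s δ) (cong₂ _+_
             (trans (⟪⊞⟫ (yd ⊞ xyc) oc s δ) (cong₂ _+_
               (trans (⟪⊞⟫ yd xyc s δ) (cong₂ _+_ (counts y-range ds) (counts xy-range cs)))
               (counts no-range cs)))
             (trans (⟪⊞⟫ FL FL s δ) (cong₂ _+_ ⟪FL⟫ ⟪FL⟫)))) ⟩
      ⟪ full b ℓ ℓ′ ⟫ᴿ ∎
      where
      cs = crossedTemplates b
      ds = doubledTemplates b
      Yc = count y-range cs ℓ ℓ′
      Xc = count x-range cs ℓ ℓ′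
      Od = count no-range ds ℓ ℓ′
      yd = count y-range ds ℓ ℓ′
      xyc = count xy-range cs ℓ ℓ′
      oc = count no-range cs ℓ ℓ′
      FL = count xy-range (planes b) ℓ ℓ′ ⊞ count x-range (lines b) ℓ ℓ′

      Kd Fx Lx : Z → ℕ
      Kd x = ∑ (pairTemplates b x) (λ B → ∑ halfSystem (ω B x))
      Fx x = ∑ (planes b) (λ B → ∑ elements (ω B x))
      Lx x = ∑ (lines b) (λ B → ω B x 0#)

      K : Z → ℕ
      K x = ∑ cs (λ B → ∑ halfSystem (ω B x))
      K₀ = K 0#
      R = ∑ (allFin (m + m)) (K ∘ suc)
      D₀ = ∑ ds (λ B → ∑ halfSystem (ω B 0#))
      F = ∑ (planes b) (λ B → ranged xy-range (ω B))
      L = ∑ (lines b) (λ B → ranged x-range (ω B))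
      Y = ∑ cs (λ B → ranged y-range (ω B))
      X = ∑ cs (λ B → ranged x-range (ω B))
      O = ∑ ds (λ B → ranged no-range (ω B))
      O′ = ∑ cs (λ B → ranged no-range (ω B))
      Yd = ∑ ds (λ B → ranged y-range (ω B))
      XY = ∑ cs (λ B → ranged xy-range (ω B))

      ⟪FL⟫ : ⟪ FL ⟫ᴿ ≡ F + L
      ⟪FL⟫ = trans (⟪⊞⟫ (count xy-range (planes b) ℓ ℓ′) (count x-range (lines b) ℓ ℓ′) s δ)
                  (cong₂ _+_ (counts xy-range (planes b)) (counts x-range (lines b)))

      XY≡ : XY ≡ X + ((K₀ + R) + (K₀ + R))
      XY≡ = begin
        XY
          ≡⟨ sym (∑-swap elements cs (λ x B → ∑ elements (ω B x))) ⟩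
        ∑ elements (λ x → ∑ cs (λ B → ∑ elements (ω B x)))
          ≡⟨ ∑-cong elements (even-half (all-even crossed-even (crossedShapes b)) p q) ⟩
        ∑ elements (λ x → ∑ cs (λ B → ω B x 0#) + (K x + K x))
          ≡⟨ trans (∑-+ elements (λ x → ∑ cs (λ B → ω B x 0#)) (λ x → K x + K x)) (cong₂ _+_ (∑-swap elements cs (λ x B → ω B x 0#)) (∑-+ elements K K)) ⟩
        X + (∑ elements K + ∑ elements K)
          ≡⟨ cong (λ v → X + (v + v)) (∑-allFin-suc K) ⟩
        X + ((K₀ + R) + (K₀ + R)) ∎

      rearrange : ∀ D R F L O′ K X O → 2 * ((D + R) + (F + L)) + (((O′ + (K + K)) + X) + O) ≡
        (((O + (D + D)) + (X + ((K + R) + (K + R)))) + O′) + ((F + L) + (F + L))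
      rearrange = solve 8 (λ D R F L O′ K X O →
        con 2 :* ((D :+ R) :+ (F :+ L)) :+ (((O′ :+ (K :+ K)) :+ X) :+ O) :=
        (((O :+ (D :+ D)) :+ (X :+ ((K :+ R) :+ (K :+ R)))) :+ O′) :+ ((F :+ L) :+ (F :+ L))) refl
        where open +-*-Solver

    total-pairs : ∀ σ → 2 * ∑ (colouredBlocks σ) (λ (c , B) → joint p q B) + ⟪ totalExcess σ ℓ ℓ′ ⟫ᴿ ≡
                        ⟪ totalFull σ ℓ ℓ′ ⟫ᴿ
    total-pairs σ = begin
      2 * ∑ (colouredBlocks σ) (λ (c , B) → joint p q B) + ⟪ totalExcess σ ℓ ℓ′ ⟫ᴿ
        ≡⟨ cong₂ (λ a c → 2 * a + c) (∑-colouredBlocks σ (λ _ → joint p q))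
             (trans (⟪⊞⟫ (∑ⁿ (allFin w) N⁻ᶜ) (∑ⁿ (allFin u) M⁻ᶜ) s δ)
                    (cong₂ _+_ (⟪∑ⁿ⟫ (allFin w) N⁻ᶜ s δ) (⟪∑ⁿ⟫ (allFin u) M⁻ᶜ s δ))) ⟩
      2 * (∑ (allFin w) N + ∑ (allFin u) M) + (∑ (allFin w) N⁻ + ∑ (allFin u) M⁻)
        ≡⟨ rearrange (∑ (allFin w) N) (∑ (allFin u) M) _ _ ⟩
      (2 * ∑ (allFin w) N + ∑ (allFin w) N⁻) + (2 * ∑ (allFin u) M + ∑ (allFin u) M⁻)
        ≡⟨ cong₂ _+_ (combineSums (allFin w) N N⁻ (λ e → bundle-pairs (bundle σ e)))
                     (combineSums (allFin u) M M⁻ (λ f → extra-pairs (extra σ f))) ⟩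
      ∑ (allFin w) (λ e → ⟪ full (bundle σ e) ℓ ℓ′ ⟫ᴿ) + ∑ (allFin u) (λ f → ⟪ extraFull (extra σ f) ℓ ℓ′ ⟫ᴿ)
        ≡⟨ sym (trans (⟪⊞⟫ (∑ⁿ (allFin w) N⁺ᶜ) (∑ⁿ (allFin u) M⁺ᶜ) s δ)
                    (cong₂ _+_ (⟪∑ⁿ⟫ (allFin w) N⁺ᶜ s δ) (⟪∑ⁿ⟫ (allFin u) M⁺ᶜ s δ))) ⟩
      ⟪ totalFull σ ℓ ℓ′ ⟫ᴿ ∎
      where
      N⁻ᶜ N⁺ᶜ : Fin w → Count
      N⁻ᶜ e = excess (bundle σ e) ℓ ℓ′
      N⁺ᶜ e = full (bundle σ e) ℓ ℓ′
      M⁻ᶜ M⁺ᶜ : Fin u → Count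
      M⁻ᶜ f = extraExcess (extra σ f) ℓ ℓ′
      M⁺ᶜ f = extraFull (extra σ f) ℓ ℓ′
      N N⁻ : Fin w → ℕ
      N e  = ∑ elements (λ x → ∑ (develop (bundle σ e) x) (joint p q))
      N⁻ e = ⟪ N⁻ᶜ e ⟫ᴿ
      M M⁻ : Fin u → ℕ
      M f  = ∑ (develop (extra σ f) 0#) (joint p q)
      M⁻ f = ⟪ M⁻ᶜ f ⟫ᴿ

      combineSums : ∀ {A : Set} (xs : List A) f f⁻ {f⁺ : A → ℕ} → (∀ x → 2 * f x + f⁻ x ≡ f⁺ x) →
                    2 * ∑ xs f + ∑ xs f⁻ ≡ ∑ xs f⁺
      combineSums xs f f⁻ eq = trans
        (cong (_+ ∑ xs f⁻) (sym (∑-*ˡ xs 2 f)))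
        (trans (sym (∑-+ xs (λ x → 2 * f x) f⁻)) (∑-cong xs eq))

      rearrange : ∀ a b c d → 2 * (a + b) + (c + d) ≡ (2 * a + c) + (2 * b + d)
      rearrange = solve 4 (λ a b c d → con 2 :* (a :+ b) :+ (c :+ d) :=
                                       (con 2 :* a :+ c) :+ (con 2 :* b :+ d)) refl
        where open +-*-Solver

    covered-pairs : ∀ σ → ⟪ totalFull σ ℓ ℓ′ ⟫ᴿ ≡ ⟪ totalExcess σ ℓ ℓ′ ⊞ target ⟫ᴿ →
      ∑ (colouredBlocks σ) (λ (c , B) → joint p q B) ≡ 2 * (u + w * s)
    covered-pairs σ eq = *-cancelˡ-≡ _ _ 2 (+-cancelʳ-≡ ⟪ totalExcess σ ℓ ℓ′ ⟫ᴿ _ _ (begin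
      2 * ∑ (colouredBlocks σ) (λ (c , B) → joint p q B) + ⟪ totalExcess σ ℓ ℓ′ ⟫ᴿ
        ≡⟨ trans (total-pairs σ) eq ⟩
      ⟪ totalExcess σ ℓ ℓ′ ⊞ target ⟫ᴿ
        ≡⟨ ⟪⊞⟫ (totalExcess σ ℓ ℓ′) target s δ ⟩
      ⟪ totalExcess σ ℓ ℓ′ ⟫ᴿ + ⟪ target ⟫ᴿ
        ≡⟨ trans (+-comm ⟪ totalExcess σ ℓ ℓ′ ⟫ᴿ _) (cong (_+ ⟪ totalExcess σ ℓ ℓ′ ⟫ᴿ) (⟪target⟫ u w s)) ⟩
      2 * (2 * (u + w * s)) + ⟪ totalExcess σ ℓ ℓ′ ⟫ᴿ ∎))
      where
      ⟪target⟫ : ∀ u w s → (4 * u) * 1 + ((4 * w) * s + 0) + 0 ≡ 2 * (2 * (u + w * s))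
      ⟪target⟫ = solve 3 (λ u w s → (con 4 :* u) :* con 1 :+ ((con 4 :* w) :* s :+ con 0) :+ con 0 :=
                                    con 2 :* (con 2 :* (u :+ w :* s))) refl
        where open +-*-Solver

  ⟪⟫-uniform : ∀ c c′ → proj₁ c ≡ proj₁ c′ → ⟪ c ⟫ s 0 ≡ ⟪ c′ ⟫ s 0
  ⟪⟫-uniform (U , V) (.U , V′) refl =
    cong (dot U powers +_) (trans (*-zeroʳ (dot V powers)) (sym (*-zeroʳ (dot V′ powers))))
    where
    powers = 1 ∷ s ∷ s * s ∷ []

  fixed-pairs : ∀ {σ} → Good σ → ∀ f j z →
    ∑ (colouredBlocks σ) (λ (c , B) → joint (inj₁ f) (inj₂ (j , z)) B) ≡ 2 * (u + w * s)
  -- Residues cannot be compared at a fixed point; δ = 0 discards V, so that the identity between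
  -- the U suffices.
  fixed-pairs {σ} (_ , _ , _ , uniform! , _) f j z = covered-pairs (inj₁ f) (inj₂ (j , z)) 0 (fixed-counted f j z 0) σ
    (⟪⟫-uniform (totalFull σ (inj₁ f) (inj₂ j)) (totalExcess σ (inj₁ f) (inj₂ j) ⊞ target) (uniform! f j))

  moving-pairs : ∀ {σ} → Good σ → ∀ {i j} → i ≤ j → ∀ z z′ → _≢_ {A = Pt} (inj₂ (i , z)) (inj₂ (j , z′)) →
    ∑ (colouredBlocks σ) (λ (c , B) → joint (inj₂ (i , z)) (inj₂ (j , z′)) B) ≡ 2 * (u + w * s)
  moving-pairs {σ} (_ , _ , _ , _ , covered!) {i} {j} i≤j z z′ p≢q =
    covered-pairs (inj₂ (i , z)) (inj₂ (j , z′)) ⟦ z′ ≟ z ⟧ (moving-counted i z j z′) σ (agree (covered! i j i≤j))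
    where
    agree : Covered σ (inj₂ i) (inj₂ j) →
            ⟪ totalFull σ (inj₂ i) (inj₂ j) ⟫ s ⟦ z′ ≟ z ⟧ ≡
            ⟪ totalExcess σ (inj₂ i) (inj₂ j) ⊞ target ⟫ s ⟦ z′ ≟ z ⟧
    agree (inj₁ (refl , U≡)) = subst
      (λ δ → ⟪ totalFull σ (inj₂ i) (inj₂ i) ⟫ s δ ≡ ⟪ totalExcess σ (inj₂ i) (inj₂ i) ⊞ target ⟫ s δ)
      (sym (⟦⟧-false (z′ ≟ z) (λ { refl → p≢q refl })))
      (⟪⟫-uniform (totalFull σ (inj₂ i) (inj₂ i)) (totalExcess σ (inj₂ i) (inj₂ i) ⊞ target) U≡)
    agree (inj₂ eq) = cong (λ c → ⟪ c ⟫ s ⟦ z′ ≟ z ⟧) eq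

  joint-comm : ∀ σ p q → ∑ (colouredBlocks σ) (λ (c , B) → joint p q B) ≡
                         ∑ (colouredBlocks σ) (λ (c , B) → joint q p B)
  joint-comm σ p q = ∑-cong (colouredBlocks σ) (λ (c , B) → *-comm (mult B p) (mult B q))

  pairs : ∀ {σ} → Good σ → ∀ p q → p ≢ q →
    ∑ (colouredBlocks σ) (λ (c , B) → joint p q B) ≡ 2 * (u + w * s)
  pairs (_ , _ , single , _) (inj₁ f) (inj₁ f′) p≢q = contradiction (cong inj₁ (single f f′)) p≢q
  pairs good (inj₁ f) (inj₂ (j , z)) p≢q = fixed-pairs good f j z
  pairs {σ} good p@(inj₂ (j , z)) q@(inj₁ f) p≢q = trans (joint-comm σ p q) (fixed-pairs good f j z)
  pairs {σ} good p@(inj₂ (i , z)) q@(inj₂ (j , z′)) p≢q with ≤-total i j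
  ... | inj₁ i≤j = moving-pairs good i≤j z z′ p≢q
  ... | inj₂ j≤i = trans (joint-comm σ p q) (moving-pairs good j≤i z′ z (p≢q ∘ sym))

-- Explicit base blocks for five and for ten copies

rotations : {A : Set} → (ℕ → A) → List A
rotations rotate = map rotate (upTo 5)

-- Classes and coefficients are tabulated by decimal digits; the digit 2 stands for -1.
digits : ℕ → ℕ → List ℕ
digits zero    d = []
digits (suc k) d = digits k (d / 10) ++ d % 10 ∷ []

coefficient : ℕ → Coeff
coefficient 0 = 0ᶜ
coefficient 1 = 1ᶜ
coefficient _ = -1ᶜ

module FiveClasses where

  open Templates 0 5

  -- The five rotations of a shape with digits distinct modulo 5 meet every copy 2 + 2 + 1 = 5
  -- times, which is the value of C that C + 2F = 5 demands without planes.
  shape : ℕ → ℕ → Shape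
  shape d r = class (d / 100) , class (d / 10) , class d
    where
    class : ℕ → Fin 5
    class c = (c % 10 + r) mod 5

  line : ℕ → ℕ → Template
  line d r = zipWith (λ c a → inj₂ ((c + r) mod 5) , coefficient a , 0ᶜ) (upTo 5) (digits 5 d)

  bundle₅ : ℕ → Bundle
  bundle₅ e = record
    { crossedShapes = shapes
    ; doubledShapes = shapes
    ; planes        = []
    -- With C = 5 and u = 0, the condition 2L + 1 = C asks for two lines through every copy.
    ; lines         = line 01122 e ∷ line 12000 e ∷ []
    }
    where
    shapes : List Shape
    -- In `full` minus `excess`, apart from the lines, a colour with shape 140 gives 4s - 4s
    -- [z = z′] between copies one apart and 4s + 2s [z = z′] - 6 between copies two apart; shape
    -- 230 exchanges the two distances. Two points of a line add 2s [z = z′] if their coefficients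
    -- agree and 2 otherwise. If k colours use 140, the two lines, read cyclically, need 3k - 5
    -- agreements at distance one and 10 - 3k at distance two, so k is 2 or 3. For k = 3 these are 4
    -- and 1, as in `01122` and `12000`.
    shapes = rotations (shape (if e <ᵇ 3 then 140 else 230))

  spec₅ : Spec
  spec₅ = record { bundle = λ e → bundle₅ (toℕ e) ; extra = λ () }

  good₅ : Good spec₅
  good₅ = toWitness {a? = good? spec₅} _

module TenClasses where

  open Templates 1 10

  -- The digits 0-4 and 5-9 are two copies of ℤ/5, rotated simultaneously by r.
  class : ℕ → ℕ → Fin 10
  class r c = (5 * (c / 5) + (c + r) % 5) mod 10

  shape : ℕ → ℕ → Shape
  shape d r = class r (d / 100) , class r (d / 10 % 10) , class r (d % 10)

  -- The five coefficient pairs are distinct, so any two entries in different copies meet for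
  -- exactly s parameter choices and planes never add a term in [z = z′].
  plane : ℕ → ℕ → Template
  plane d r = zipWith (λ c ab → inj₂ (class r c) , ab) (digits 5 d)
    ((0ᶜ , 0ᶜ) ∷ (1ᶜ , 0ᶜ) ∷ (0ᶜ , 1ᶜ) ∷ (1ᶜ , 1ᶜ) ∷ (1ᶜ , -1ᶜ) ∷ [])

  line : ℕ → ℕ → ℕ → Template
  line d a r = (inj₁ zero , 0ᶜ , 0ᶜ) ∷
    zipWith (λ c a → inj₂ (class r c) , coefficient a , 0ᶜ) (digits 4 d) (digits 4 a)

  record Row : Set where
    constructor row
    field
      crossed₁ crossed₂ doubled₁ doubled₂ planeClasses lineClasses lineCoefficients : ℕ

  -- Found by computer search.
  rows : Vec Row 10
  rows =
    row 250 190  250 190  02578  0257 0120 ∷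
    row 340 560  340 560  01569  0267 0102 ∷
    row 230 790  230 790  01579  0259 0012 ∷
    row 490 170  045 465  02789  0256 0122 ∷
    row 240 570  240 570  01568  0157 0120 ∷
    row 695 035  695 035  01367  0179 0102 ∷
    row 285 165  285 165  01367  0159 0122 ∷
    row 785 345  785 345  01367  0158 0102 ∷
    row 375 475  375 475  01289  0268 0001 ∷
    row 265 295  265 295  01357  0168 0112 ∷ []

  bundle₁₀ : Fin 10 → Bundle
  bundle₁₀ e = record
    { crossedShapes = rotations (shape crossed₁) ++ rotations (shape crossed₂)
    ; doubledShapes = rotations (shape doubled₁) ++ rotations (shape doubled₂)
    ; planes        = rotations (plane planeClasses)
    -- The shapes meet a copy six times in the colour's own half and four times in the other half,
    -- so 2L = C asks for three and two lines. The rotated lines give two everywhere; this line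
    -- through the own half, turned along with the colour, adds the third.
    ; lines         = zipWith (λ c a → inj₂ (class (toℕ e) (5 * (toℕ e / 5) + c)) , coefficient a , 0ᶜ)
                        (upTo 5) (digits 5 01102) ∷
                      rotations (line lineClasses lineCoefficients)
    }
    where
    open Row (Vec.lookup rows e)

  extra₁₀ : Bundle
  extra₁₀ = record
    { crossedShapes = shapes
    ; doubledShapes = shapes
    -- As x is 0 for a fixed colour, only coefficients of y can separate the points.
    ; planes        = rotations (λ r → zipWith (λ c b → inj₂ (class r c) , 0ᶜ , coefficient b)
                        (digits 5 01289) (digits 5 01210))
    ; lines         = map (λ c → inj₂ (class 0 (5 + c)) , 0ᶜ , 0ᶜ) (upTo 5) ∷
                      rotations (line 0168 0000)
    }
    where
    shapes : List Shape
    shapes = rotations (shape 680) ++ rotations (shape 490)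

  spec₁₀ : Spec
  spec₁₀ = record { bundle = bundle₁₀ ; extra = λ _ → extra₁₀ }

  good₁₀ : Good spec₁₀
  good₁₀ = toWitness {a? = good? spec₁₀} _

-- Assembly for the two residue classes modulo 20

module _ {u w : ℕ} (m h : ℕ) (odd : h + h + 1 ≡ u + w * suc (m + m)) where

  open Templates u w
  open Realisation u w m
  open FromColouring _≟ᴾ_ encode decode decode-encode encode-decode
  open PairCounts u w m using (pairs)

  configured-GDD : ∀ σ → Good σ → let n = u + w * suc (m + m) in
                   ∃ λ (D : GDD n 2 6 (2 * n) (n ∸ 1)) → HasConfiguration 1 5 D
  configured-GDD σ good = design , configuration
    where
    open Construction h odd (colouredBlocks σ) (colouredBlocks-proper good) (pairs good)
      (λ c p → colourClass-regular good c p h odd)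

corollary7p2 : (n : ℕ) → 0 < n →
    (n % 20 ≡ 11) ⊎ (n % 20 ≡ 15) → n ≢ 15 →
    ∃ λ (D : GDD n 2 6 (2 * n) (n ∸ 1)) → HasConfiguration 1 5 D
corollary7p2 n _ (inj₁ n≡11) _ = subst
  (λ n → ∃ λ (D : GDD n 2 6 (2 * n) (n ∸ 1)) → HasConfiguration 1 5 D)
  (sym (trans (m≡m%n+[m/n]*n n 20) (trans (cong (_+ t * 20) n≡11) (form t))))
  -- Here n = 11 + 20t = 1 + 10s with s = 2t + 1, so m = t and h = 5s.
  (configured-GDD t (10 * t + 5) (odd t) TenClasses.spec₁₀ TenClasses.good₁₀)
  where
  open +-*-Solver
  t = n / 20
  form : ∀ t → 11 + t * 20 ≡ 1 + 10 * suc (t + t)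
  form = solve 1 (λ t → con 11 :+ t :* con 20 := con 1 :+ con 10 :* (con 1 :+ (t :+ t))) refl
  odd : ∀ t → 10 * t + 5 + (10 * t + 5) + 1 ≡ 1 + 10 * suc (t + t)
  odd = solve 1 (λ t → con 10 :* t :+ con 5 :+ (con 10 :* t :+ con 5) :+ con 1 :=
                       con 1 :+ con 10 :* (con 1 :+ (t :+ t))) refl
corollary7p2 n _ (inj₂ n≡15) _ = subst
  (λ n → ∃ λ (D : GDD n 2 6 (2 * n) (n ∸ 1)) → HasConfiguration 1 5 D)
  (sym (trans (m≡m%n+[m/n]*n n 20) (trans (cong (_+ t * 20) n≡15) (form t))))
  -- Here n = 15 + 20t = 5s with s = 4t + 3, so m = 2t + 1 and h = (5s - 1)/2 = 5m + 2.
  (configured-GDD (2 * t + 1) (5 * (2 * t + 1) + 2) (odd t) FiveClasses.spec₅ FiveClasses.good₅)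
  where
  open +-*-Solver
  t = n / 20
  form : ∀ t → 15 + t * 20 ≡ 5 * suc (2 * t + 1 + (2 * t + 1))
  form = solve 1 (λ t → con 15 :+ t :* con 20 :=
                        con 5 :* (con 1 :+ (con 2 :* t :+ con 1 :+ (con 2 :* t :+ con 1)))) refl
  odd : ∀ t → 5 * (2 * t + 1) + 2 + (5 * (2 * t + 1) + 2) + 1 ≡ 5 * suc (2 * t + 1 + (2 * t + 1))
  odd = solve 1 (λ t → con 5 :* (con 2 :* t :+ con 1) :+ con 2 :+ (con 5 :* (con 2 :* t :+ con 1) :+ con 2) :+ con 1 :=
                       con 5 :* (con 1 :+ (con 2 :* t :+ con 1 :+ (con 2 :* t :+ con 1)))) refl
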